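{- Let $p$ be a prime, and let $r\in\mathbb Z$ and $a,l,n,s,t\in\mathbb N$ with $a\geqslant 2$ and $s,t<p$. Then $$\left\{\begin{matrix} pn+s\\ pr+t\end{matrix}\right\}_{l,p^{a+1}}\equiv(-1)^t\binom st\left\{\begin{matrix} n\\ r\end{matrix}\right\}_{l,p^{a}}\pmod p .$$
   Context: $\mathbb N=\{0,1,2,\ldots\}$. Binomial coefficients: $\binom x0=1$, $\binom xk=x(x-1)\cdots(x-k+1)/k!$ for $k\in\mathbb Z^+$ (for arbitrary rational $x$), and $\binom x{k}=0$ for negative integers $k$. For a prime $p$, $b\in\mathbb Z^+$, $l,n\in\mathbb N$ and $r\in\mathbb Z$, the normalized cyclotomic $\psi$-coefficient is $$\left\{\begin{matrix} n\\ r\end{matrix}\right\}_{l,p^{b}}:=p^{ -\left\lfloor\frac{n-p^{b-1}-lp^{b}}{\phi(p^{b})}\right\rfloor}\sum_{k\equiv r\,(\mathrm{mod}\ p^{b})}(-1)^k\binom nk\binom{(k-r)/p^{b}}l,$$ where the sum is over all integers $k\equiv r \pmod{p^b}$ (only $0\le k\le n$ contribute), $\phi$ is Euler's totient function and $\lfloor\cdot\rfloor$ the floor function. These numbers are integers. -}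

module Defs where

open import Data.Nat as ℕ using (ℕ; zero; suc; _!)
open import Data.Nat.Combinatorics using (_C_)
open import Data.Nat.GCD using (gcd)
open import Data.Bool using (if_then_else_)
open import Data.Integer as ℤ using (ℤ; +_; -[1+_]; _+_; _-_; _*_; -_; _/_)
open import Data.Integer.Divisibility using (_∣_)
open import Data.Integer.Properties using (_≟_)
open import Data.Integer.Divisibility.Signed using (_∣?_)
open import Relation.Nullary.Decidable using (does)

sgn : ℕ → ℤ
sgn zero = + 1
sgn (suc k) = - sgn k

_^ℤ_ : ℤ → ℕ → ℤ
x ^ℤ zero = + 1
x ^ℤ suc k = x * (x ^ℤ k)

totient : ℕ → ℕ
totient m = go m
  where
  go : ℕ → ℕ
  go zero = 0
  go (suc k) = (if (gcd (suc k) m ℕ.≡ᵇ 1) then 1 else 0) ℕ.+ go k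

-- integer division by a natural number; only ever used with nonzero
-- divisor (division by 0 returns 0, a junk value never reached here)
_÷_ : ℤ → ℕ → ℤ
x ÷ zero = + 0
x ÷ suc d = x / (+ suc d)

falling : ℤ → ℕ → ℤ
falling x zero = + 1
falling x (suc l) = falling x l * (x - + l)

binomℤ : ℤ → ℕ → ℤ
binomℤ x l = falling x l ÷ (l !)

psiSum : ℕ → ℤ → ℕ → ℕ → ℤ
psiSum n r l q = go (suc n)
  where
  term : ℕ → ℤ
  term k = if does ((+ q) ∣? (+ k - r))
             then sgn k * (+ (n C k)) * binomℤ ((+ k - r) ÷ q) l
             else + 0
  go : ℕ → ℤ
  go zero = + 0
  go (suc m) = go m + term m

-- multiply by p^{-e} for an integer e (exact division when e > 0)
scaleNeg : ℕ → ℤ → ℤ → ℤ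
scaleNeg p (+ e) x = x ÷ (p ℕ.^ e)
scaleNeg p -[1+ e ] x = x * ((+ p) ^ℤ suc e)

psi : (p b l n : ℕ) → ℤ → ℤ
psi p b l n r =
  scaleNeg p
    (((+ n - + (p ℕ.^ (b ℕ.∸ 1))) - + (l ℕ.* (p ℕ.^ b))) ÷ totient (p ℕ.^ b))
    (psiSum n r l (p ℕ.^ b))

_≡_[mod_] : ℤ → ℤ → ℕ → Set
x ≡ y [mod m ] = (+ m) ∣ (x - y)

-- Let Δ f k = f k - f (k + 1), ∇ h f k = f k - f (k + h) and q = p ^ b.  The sum in ψ is (Δⁿ f)(0) for
-- f k = [q ∣ k - r] C((k - r)/q, l), a function killed by ∇ q applied l + 1 times.
-- Give p the weight φ(q), Δ the weight 1 and ∇ q the weight q.  Expanding the shift by q in powers of Δ,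
-- Δ^q equals ± ∇ q up to terms of weight at least q: for 0 < i < q, either p² divides C(q, i), or p does and
-- i ≥ q/p.  Hence p ^ (1 + ⌊(n - (l + 1) q) / φ(q)⌋) divides Δⁿ f; as q = φ(q) + p ^ (b - 1), this is the
-- integrality of ψ.
-- At level p ^ (a + 1) one has ∇ p = Δ^p + E, where E has weight φ + 1 (φ being φ(p ^ (a + 1)) here), so
-- (∇ p)ⁿ = Δ^(pn) + n Δ^(p(n-1)) E modulo higher weight.  The middle term loses at most p - 1 against the
-- weight pn + φ that is wanted.  Either p ∣ n, which contributes another φ, or, everything
-- else in the bound for n being divisible by p as a ≥ 2, that bound is strict, which leaves p to spare.
-- Finally Δ^s (∇ p)ⁿ at level p ^ (a + 1) is exactly (-1)^t C(s, t) Δⁿ at level p ^ a, because the kernel is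
-- supported on the residue class of t modulo p and s, t < p.
module Submission where

open import Defs
open import Data.Nat using (ℕ; _≥_; _<_; _*_; _+_)
open import Data.Nat.Primality using (Prime)
open import Data.Nat.Combinatorics using (_C_)
open import Data.Integer using (ℤ; +_)
open import Data.Integer as ℤ using (-[1+_]; 0ℤ; _%ℕ_)

open import Data.Bool as Bool using (true; false; if_then_else_)
open import Data.Empty using (⊥-elim)
open import Data.Integer.DivMod using (n%ℕd<d; a≡a%ℕn+[a/ℕn]*n; div-pos-is-/ℕ)
open import Data.Integer.Divisibility.Signed as ℤ using (divides) renaming (_∣_ to _∣ᶻ_; _∣?_ to _∣ᶻ?_)
import Data.Integer.Properties as ℤ
open import Data.Integer.Tactic.RingSolver using (solve-∀)
open import Data.Nat as ℕ using (zero; suc; _≤_; _∸_; _^_; _!; z≤n; s≤s)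
open import Data.Nat.Combinatorics using (nCn≡1; nCk+nC[k+1]≡[n+1]C[k+1]; k>n⇒nCk≡0)
open import Data.Nat.Coprimality as Coprimality using (Coprime; prime⇒coprime; coprime⇒gcd≡1; gcd≡1⇒coprime)
open import Data.Nat.Divisibility using (_∣_; _∣?_; divides; ∣⇒≤; ∣-refl; ∣-trans; ∣m∣n⇒∣m+n; ∣m+n∣m⇒∣n; ∣m⇒∣m*n; ∣n⇒∣m*n; m∣m*n; n∣m*n; *-monoʳ-∣; *-cancelˡ-∣; _∣0; ∣1⇒≡1)
open import Data.Nat.GCD using (gcd)
open import Data.Nat.GeneralisedArithmetic using (fold; fold-+)
open import Data.Nat.Induction using (<-rec)
open import Data.Nat.Primality using (euclidsLemma; prime⇒nonZero; prime⇒nonTrivial; prime⇒irreducible; ¬prime[1])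
import Data.Nat.Properties as ℕ
import Data.Nat.Tactic.RingSolver as ℕSolver
open import Data.Product using (_×_; _,_; ∃₂)
open import Data.Sum using (_⊎_; inj₁; inj₂)
open import Function using (_∘_)
open import Relation.Binary.PropositionalEquality
open import Relation.Nullary using (¬_; contradiction; yes; no)
open import Relation.Nullary.Decidable using (does; dec-true; dec-false)

-- Finite sums and iterated differences.

Seq : Set
Seq = ℕ → ℤ

∇ : ℕ → Seq → Seq
∇ h f k = f k ℤ.- f (k + h)

Δ : Seq → Seq
Δ f k = f k ℤ.- f (suc k)

D : ℕ → Seq → Seq
D n f = fold f Δ n

Σ< : ℕ → Seq → ℤ
Σ< zero    u = 0ℤ
Σ< (suc n) u = Σ< n u ℤ.+ u n

Σ<-cong : ∀ n {u v : Seq} → u ≗ v → Σ< n u ≡ Σ< n v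
Σ<-cong zero    u≗v = refl
Σ<-cong (suc n) u≗v = cong₂ ℤ._+_ (Σ<-cong n u≗v) (u≗v n)

Σ<-suc : ∀ n u → Σ< (suc n) u ≡ u 0 ℤ.+ Σ< n (u ∘ suc)
Σ<-suc zero    u = ℤ.+-comm 0ℤ (u 0)
Σ<-suc (suc n) u = trans (cong (ℤ._+ u (suc n)) (Σ<-suc n u)) (ℤ.+-assoc (u 0) _ _)

Σ<-zero : ∀ n {u} → (∀ i → i < n → u i ≡ 0ℤ) → Σ< n u ≡ 0ℤ
Σ<-zero zero    u≡0 = refl
Σ<-zero (suc n) u≡0 = cong₂ ℤ._+_ (Σ<-zero n λ i i<n → u≡0 i (ℕ.m≤n⇒m≤1+n i<n)) (u≡0 n ℕ.≤-refl)

Σ<-sub : ∀ n u v → Σ< n (λ i → u i ℤ.- v i) ≡ Σ< n u ℤ.- Σ< n v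
Σ<-sub zero    u v = refl
Σ<-sub (suc n) u v = trans (cong (ℤ._+ (u n ℤ.- v n)) (Σ<-sub n u v)) (lemma (Σ< n u) (Σ< n v) (u n) (v n))
  where
  lemma : ∀ a b c d → a ℤ.- b ℤ.+ (c ℤ.- d) ≡ a ℤ.+ c ℤ.- (b ℤ.+ d)
  lemma = solve-∀

Σ<-∣ : ∀ {d} n {u} → (∀ i → i < n → d ∣ᶻ u i) → d ∣ᶻ Σ< n u
Σ<-∣ zero    d∣u = divides 0ℤ refl
Σ<-∣ (suc n) d∣u = ℤ.∣m∣n⇒∣m+n (Σ<-∣ n λ i i<n → d∣u i (ℕ.m≤n⇒m≤1+n i<n)) (d∣u n ℕ.≤-refl)

signedC : ℕ → ℕ → ℤ
signedC n i = sgn i ℤ.* + (n C i)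

signedC-suc : ∀ n i → signedC (suc n) (suc i) ≡ signedC n (suc i) ℤ.- signedC n i
signedC-suc n i = trans (cong (λ c → ℤ.- sgn i ℤ.* + c) (sym (nCk+nC[k+1]≡[n+1]C[k+1] n i)))
  (lemma (sgn i) (+ (n C i)) (+ (n C suc i)))
  where
  lemma : ∀ s a b → ℤ.- s ℤ.* (a ℤ.+ b) ≡ ℤ.- s ℤ.* b ℤ.- s ℤ.* a
  lemma = solve-∀

-- Induction on `n` by Pascal's rule. The array `w` is left abstract because two arrays satisfy the
-- same recurrence: `D n f j`, which expands differences in values, and `D j f (x + n)`, which
-- expands a shift in differences.
difference-expansion : (w : ℕ → Seq) → (∀ n j → w (suc n) j ≡ w n j ℤ.- w n (suc j)) →
  ∀ n j → w n j ≡ Σ< (suc n) (λ i → signedC n i ℤ.* w 0 (j + i))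
difference-expansion w w-suc zero j =
  trans (cong (w 0) (sym (ℕ.+-identityʳ j))) (lemma (w 0 (j + 0)))
  where
  lemma : ∀ x → x ≡ 0ℤ ℤ.+ + 1 ℤ.* x
  lemma = solve-∀
difference-expansion w w-suc (suc n) j = begin
  w (suc n) j                   ≡⟨ w-suc n j ⟩
  w n j ℤ.- w n (suc j)         ≡⟨ cong₂ ℤ._-_ (difference-expansion w w-suc n j) (difference-expansion w w-suc n (suc j)) ⟩
  -- The term of index `n + 1` has coefficient C(n, n + 1) = 0; adding it lets the first sum be
  -- re-indexed from its second term.
  Σ< (suc n) u ℤ.- Σ< (suc n) v ≡⟨ cong (ℤ._- Σ< (suc n) v) (sym (trans (cong (λ z → Σ< (suc n) u ℤ.+ z) u[1+n]≡0) (ℤ.+-identityʳ (Σ< (suc n) u)))) ⟩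
  Σ< (suc (suc n)) u ℤ.- Σ< (suc n) v ≡⟨ cong (ℤ._- Σ< (suc n) v) (Σ<-suc (suc n) u) ⟩
  (u 0 ℤ.+ Σ< (suc n) (u ∘ suc)) ℤ.- Σ< (suc n) v ≡⟨ ℤ.+-assoc (u 0) _ _ ⟩
  u 0 ℤ.+ (Σ< (suc n) (u ∘ suc) ℤ.- Σ< (suc n) v) ≡⟨ cong (λ z → u 0 ℤ.+ z) (sym (Σ<-sub (suc n) (u ∘ suc) v)) ⟩
  u 0 ℤ.+ Σ< (suc n) (λ i → u (suc i) ℤ.- v i) ≡⟨ cong (λ z → t 0 ℤ.+ z) (Σ<-cong (suc n) step) ⟩
  t 0 ℤ.+ Σ< (suc n) (t ∘ suc) ≡⟨ sym (Σ<-suc (suc n) t) ⟩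
  Σ< (suc (suc n)) t ∎
  where
  open ≡-Reasoning
  u v t : Seq
  u i = signedC n i ℤ.* w 0 (j + i)
  v i = signedC n i ℤ.* w 0 (suc j + i)
  t i = signedC (suc n) i ℤ.* w 0 (j + i)
  u[1+n]≡0 : u (suc n) ≡ 0ℤ
  u[1+n]≡0 = begin
    sgn (suc n) ℤ.* + (n C suc n) ℤ.* w 0 (j + suc n) ≡⟨ cong (λ c → sgn (suc n) ℤ.* + c ℤ.* w 0 (j + suc n)) (k>n⇒nCk≡0 (ℕ.n<1+n n)) ⟩
    sgn (suc n) ℤ.* + 0 ℤ.* w 0 (j + suc n) ≡⟨ cong (ℤ._* w 0 (j + suc n)) (ℤ.*-zeroʳ (sgn (suc n))) ⟩
    0ℤ ∎
  step : ∀ i → u (suc i) ℤ.- v i ≡ t (suc i)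
  step i = begin
    signedC n (suc i) ℤ.* w 0 (j + suc i) ℤ.- signedC n i ℤ.* w 0 (suc j + i)
      ≡⟨ cong (λ m → signedC n (suc i) ℤ.* w 0 (j + suc i) ℤ.- signedC n i ℤ.* w 0 m) (sym (ℕ.+-suc j i)) ⟩
    signedC n (suc i) ℤ.* w 0 (j + suc i) ℤ.- signedC n i ℤ.* w 0 (j + suc i)
      ≡⟨ lemma (signedC n (suc i)) (signedC n i) (w 0 (j + suc i)) ⟩
    (signedC n (suc i) ℤ.- signedC n i) ℤ.* w 0 (j + suc i) ≡⟨ cong (ℤ._* w 0 (j + suc i)) (sym (signedC-suc n i)) ⟩
    t (suc i) ∎
    where
    lemma : ∀ a b c → a ℤ.* c ℤ.- b ℤ.* c ≡ (a ℤ.- b) ℤ.* c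
    lemma = solve-∀

D-expansion : ∀ n f k → D n f k ≡ Σ< (suc n) (λ i → signedC n i ℤ.* f (k + i))
D-expansion n f = difference-expansion (λ n → D n f) (λ _ _ → refl) n

-- The shift by 1 is 1 - Δ, so this is the binomial theorem for (1 - Δ)ⁿ.
shift-expansion : ∀ n f x → f (x + n) ≡ Σ< (suc n) (λ i → signedC n i ℤ.* D i f x)
shift-expansion n f x = trans
  (difference-expansion (λ n j → D j f (x + n)) step n 0)
  (Σ<-cong (suc n) λ i → cong (λ y → signedC n i ℤ.* D i f y) (ℕ.+-identityʳ x))
  where
  step : ∀ n j → D j f (x + suc n) ≡ D j f (x + n) ℤ.- D (suc j) f (x + n)
  step n j = trans (cong (D j f) (ℕ.+-suc x n)) (lemma (D j f (x + n)) _)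
    where
    lemma : ∀ a b → b ≡ a ℤ.- (a ℤ.- b)
    lemma = solve-∀

D-cong : ∀ n {f g : Seq} → f ≗ g → D n f ≗ D n g
D-cong zero    f≗g k = f≗g k
D-cong (suc n) f≗g k = cong₂ ℤ._-_ (D-cong n f≗g k) (D-cong n f≗g (suc k))

D-+ : ∀ n f g k → D n (λ x → f x ℤ.+ g x) k ≡ D n f k ℤ.+ D n g k
D-+ zero    f g k = refl
D-+ (suc n) f g k = trans (cong₂ ℤ._-_ (D-+ n f g k) (D-+ n f g (suc k))) (lemma (D n f k) _ _ _)
  where
  lemma : ∀ a b c d → a ℤ.+ b ℤ.- (c ℤ.+ d) ≡ a ℤ.- c ℤ.+ (b ℤ.- d)
  lemma = solve-∀

D-* : ∀ n c f k → D n (λ x → c ℤ.* f x) k ≡ c ℤ.* D n f k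
D-* zero    c f k = refl
D-* (suc n) c f k = trans (cong₂ ℤ._-_ (D-* n c f k) (D-* n c f (suc k))) (lemma c (D n f k) _)
  where
  lemma : ∀ c a b → c ℤ.* a ℤ.- c ℤ.* b ≡ c ℤ.* (a ℤ.- b)
  lemma = solve-∀

D-∇ : ∀ n h f → D n (∇ h f) ≗ ∇ h (D n f)
D-∇ zero    h f k = refl
D-∇ (suc n) h f k = trans (cong₂ ℤ._-_ (D-∇ n h f k) (D-∇ n h f (suc k))) (lemma (D n f k) _ _ _)
  where
  lemma : ∀ a b c d → a ℤ.- b ℤ.- (c ℤ.- d) ≡ a ℤ.- c ℤ.- (b ℤ.- d)
  lemma = solve-∀

-- Powers of p in the binomial coefficients of a prime power.

absorption : ∀ n k → suc k * (suc n C suc k) ≡ suc n * (n C k)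
absorption zero    zero    = refl
absorption zero    (suc k) = trans (cong (suc (suc k) *_) (k>n⇒nCk≡0 {1} {suc (suc k)} (s≤s (s≤s z≤n))))
  (trans (ℕ.*-zeroʳ k) (sym (cong (_+ 0) (k>n⇒nCk≡0 {0} {suc k} (s≤s z≤n)))))
absorption (suc n) zero    = begin
  1 * (suc (suc n) C 1)              ≡⟨ cong (1 *_) (nCk+nC[k+1]≡[n+1]C[k+1] (suc n) 0) ⟨
  1 * (1 + (suc n C 1))              ≡⟨ cong suc (absorption n zero) ⟩
  suc (suc n * 1)                    ∎
  where open ≡-Reasoning
absorption (suc n) (suc k) = begin
  suc (suc k) * (suc (suc n) C suc (suc k))
    ≡⟨ cong (suc (suc k) *_) (nCk+nC[k+1]≡[n+1]C[k+1] (suc n) (suc k)) ⟨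
  suc (suc k) * (c + (suc n C suc (suc k)))
    ≡⟨ split (suc k) c (suc n C suc (suc k)) ⟩
  c + (suc k * c + suc (suc k) * (suc n C suc (suc k)))
    ≡⟨ cong (λ m → c + m) (cong₂ _+_ (absorption n k) (absorption n (suc k))) ⟩
  c + (suc n * (n C k) + suc n * (n C suc k))
    ≡⟨ cong (λ m → c + m) (sym (ℕ.*-distribˡ-+ (suc n) (n C k) (n C suc k))) ⟩
  c + suc n * ((n C k) + (n C suc k))
    ≡⟨ cong (λ z → c + suc n * z) (nCk+nC[k+1]≡[n+1]C[k+1] n k) ⟩
  suc (suc n) * c ∎
  where
  open ≡-Reasoning
  c = suc n C suc k
  split : ∀ k a b → suc k * (a + b) ≡ a + (k * a + suc k * b)
  split = ℕSolver.solve-∀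

module _ {p : ℕ} (p-prime : Prime p) where

  private instance
    p≢0 = prime⇒nonZero p-prime

  -- Euclid's lemma removes one factor p at a time, from `k` or from `c`.
  p^∣product : ∀ a k c → p ^ a ∣ k * c → ∃₂ λ v j → p ^ v ∣ k × p ^ j ∣ c × v + j ≡ a
  p^∣product zero    k c _ = 0 , 0 , divides k (sym (ℕ.*-identityʳ k)) , divides c (sym (ℕ.*-identityʳ c)) , refl
  p^∣product (suc a) k c p^∣kc with euclidsLemma k c p-prime (∣-trans (m∣m*n (p ^ a)) p^∣kc)
  ... | inj₁ (divides k′ refl) with p^∣product a k′ c (*-cancelˡ-∣ p (subst (p ^ suc a ∣_) (reorder k′ p c) p^∣kc))
    where
    reorder : ∀ k p c → k * p * c ≡ p * (k * c)
    reorder = ℕSolver.solve-∀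
  ...   | v , j , p^v∣k , p^j∣c , v+j≡a =
    suc v , j , subst (p ^ suc v ∣_) (ℕ.*-comm p k′) (*-monoʳ-∣ p p^v∣k) , p^j∣c , cong suc v+j≡a
  p^∣product (suc a) k c p^∣kc | inj₂ (divides c′ refl) with p^∣product a k c′ (*-cancelˡ-∣ p (subst (p ^ suc a ∣_) (reorder k p c′) p^∣kc))
    where
    reorder : ∀ k p c → k * (c * p) ≡ p * (k * c)
    reorder = ℕSolver.solve-∀
  ...   | v , j , p^v∣k , p^j∣c , v+j≡a =
    v , suc j , p^v∣k , subst (p ^ suc j ∣_) (ℕ.*-comm p c′) (*-monoʳ-∣ p p^j∣c) , trans (ℕ.+-suc v j) (cong suc v+j≡a)

  -- By absorption q = p ^ (b + 1) divides k C(q, k), so p ^ v divides k and p ^ j divides C(q, k)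
  -- for some v + j = b + 1. If j = 0 then q ≤ k, which is excluded; if j = 1 then p ^ b divides k.
  p∣p^[1+b]Ck : ∀ b k → 0 < k → k < p ^ suc b →
    p * p ∣ p ^ suc b C k ⊎ p ∣ p ^ suc b C k × p ^ b ≤ k
  p∣p^[1+b]Ck b (suc k) 0<k k<q with p^∣product (suc b) (suc k) (p ^ suc b C suc k) (n∣k*nCk (p ^ suc b))
    where
    n∣k*nCk : ∀ n → n ∣ suc k * (n C suc k)
    n∣k*nCk zero    = subst (0 ∣_) (sym (ℕ.*-zeroʳ k)) (0 ∣0)
    n∣k*nCk (suc n) = subst (suc n ∣_) (sym (absorption n k)) (m∣m*n _)
  ... | v , zero , p^v∣k , _ , v+0≡1+b = contradiction
    (subst (λ v → p ^ v ≤ suc k) (trans (sym (ℕ.+-identityʳ v)) v+0≡1+b) (∣⇒≤ p^v∣k)) (ℕ.<⇒≱ k<q)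
  ... | v , suc zero , p^v∣k , p∣C , v+1≡1+b = inj₂
    ( subst (_∣ p ^ suc b C suc k) (ℕ.*-identityʳ p) p∣C
    , subst (λ v → p ^ v ≤ suc k) (ℕ.suc-injective (trans (ℕ.+-comm 1 v) v+1≡1+b)) (∣⇒≤ p^v∣k))
  ... | v , suc (suc j) , p^v∣k , p^j∣C , _ = inj₁ (∣-trans (*-monoʳ-∣ p (m∣m*n (p ^ j))) p^j∣C)

  -- Euler's totient at a prime power.

  coprime-p^ : ∀ b {i} → Coprime i p → Coprime i (p ^ b)
  coprime-p^ zero    i⊥p (_ , d∣1) = ∣1⇒≡1 d∣1
  coprime-p^ (suc b) i⊥p (d∣i , d∣q) = coprime-p^ b i⊥p
    (d∣i , Coprimality.coprime-divisor (λ (e∣d , e∣p) → i⊥p (∣-trans e∣d d∣i , e∣p)) d∣q)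

-- The local function go of totient has no name outside Defs.  totient m is go m m, and no unification problem that
-- mentions only that diagonal determines go; abstracting suc m in go (suc m) m separates the two
-- arguments, so that the underscore is solved by go itself.
mutual
  totPre : ℕ → ℕ
  totPre = _
  totPre-spec : ∀ m → totient (suc m) ≡ (if (gcd (suc m) (suc m) ℕ.≡ᵇ 1) then 1 else 0) ℕ.+ totPre m
  totPre-spec m = refl

mutual
  totGo : ℕ → ℕ → ℕ
  totGo = _
  totGo-spec : ∀ m → totPre m ≡ totGo (suc m) m
  totGo-spec m with suc m
  ... | w = refl

totGo-coprime : ∀ m k → Coprime (suc k) m → totGo m (suc k) ≡ suc (totGo m k)
totGo-coprime m k k⊥m rewrite coprime⇒gcd≡1 k⊥m = refl

totGo-¬coprime : ∀ m k → ¬ Coprime (suc k) m → totGo m (suc k) ≡ totGo m k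
totGo-¬coprime m k ¬k⊥m with gcd (suc k) m ℕ.≡ᵇ 1 in eq
... | true  = ⊥-elim (¬k⊥m (gcd≡1⇒coprime (ℕ.≡ᵇ⇒≡ (gcd (suc k) m) 1 (subst Bool.T (sym eq) _))))
... | false = refl

module _ {p : ℕ} (p-prime : Prime p) (b : ℕ) where

  private instance
    p≢0 = prime⇒nonZero p-prime

  totGo-block : ∀ j i → i < p → totGo (p ^ suc b) (i + j * p) ≡ i + totGo (p ^ suc b) (j * p)
  totGo-block j zero    _   = refl
  totGo-block j (suc i) i<p = trans
    (totGo-coprime (p ^ suc b) (i + j * p) (coprime-p^ p-prime (suc b) coprime))
    (cong suc (totGo-block j i (ℕ.<-trans (ℕ.n<1+n i) i<p)))
    where
    coprime : Coprime (suc i + j * p) p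
    coprime {d} (d∣n , d∣p) = prime⇒coprime p-prime i<p
      (d∣p , ∣m+n∣m⇒∣n (subst (d ∣_) (ℕ.+-comm (suc i) (j * p)) d∣n) (∣n⇒∣m*n j d∣p))

  -- Each block of p consecutive numbers ends in a multiple of p; the p - 1 numbers before it are
  -- coprime to p, hence to its powers.
  totGo-blocks : ∀ j → totGo (p ^ suc b) (j * p) ≡ j * (p ∸ 1)
  totGo-blocks zero    = refl
  totGo-blocks (suc j) = begin
    totGo q (p + j * p)            ≡⟨ cong (λ n → totGo q (n + j * p)) (sym (ℕ.suc-pred p)) ⟩
    totGo q (suc (p ∸ 1 + j * p))  ≡⟨ totGo-¬coprime q (p ∸ 1 + j * p) not-coprime ⟩
    totGo q (p ∸ 1 + j * p)        ≡⟨ totGo-block j (p ∸ 1) (ℕ.≤-reflexive (ℕ.suc-pred p)) ⟩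
    p ∸ 1 + totGo q (j * p)        ≡⟨ cong (λ m → p ∸ 1 + m) (totGo-blocks j) ⟩
    p ∸ 1 + j * (p ∸ 1)            ∎
    where
    open ≡-Reasoning
    q = p ^ suc b
    not-coprime : ¬ Coprime (suc (p ∸ 1 + j * p)) q
    not-coprime c⊥q = ¬prime[1] (subst Prime (c⊥q (p∣ , m∣m*n (p ^ b))) p-prime)
      where
      p∣ : p ∣ suc (p ∸ 1 + j * p)
      p∣ = subst (λ n → p ∣ n + j * p) (sym (ℕ.suc-pred p)) (∣m∣n⇒∣m+n ∣-refl (n∣m*n j))

  totient-p^ : totient (p ^ suc b) ≡ p ^ b * (p ∸ 1)
  totient-p^ = trans (cong (totGo (p ^ suc b)) (ℕ.*-comm p (p ^ b))) (totGo-blocks (p ^ b))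

-- Signs, and the expansion of a long difference in powers of Δ.

sgn²≡1 : ∀ n → sgn n ℤ.* sgn n ≡ + 1
sgn²≡1 zero    = refl
sgn²≡1 (suc n) = trans (lemma (sgn n)) (sgn²≡1 n)
  where
  lemma : ∀ s → ℤ.- s ℤ.* ℤ.- s ≡ s ℤ.* s
  lemma = solve-∀

∣-sgn* : ∀ {d} n y → d ∣ᶻ sgn n ℤ.* y → d ∣ᶻ y
∣-sgn* {d} n y d∣ = subst (d ∣ᶻ_)
  (trans (sym (ℤ.*-assoc (sgn n) (sgn n) y)) (trans (cong (ℤ._* y) (sgn²≡1 n)) (ℤ.*-identityˡ y)))
  (ℤ.∣n⇒∣m*n (sgn n) d∣)

∣⇒∣ᶻ : ∀ {m n} → m ∣ n → + m ∣ᶻ + n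
∣⇒∣ᶻ = ℤ.∣ᵤ⇒∣

*-pres-∣ᶻ : ∀ {i j m n} → i ∣ᶻ m → j ∣ᶻ n → i ℤ.* j ∣ᶻ m ℤ.* n
*-pres-∣ᶻ {i} {j} {m} {n} i∣m j∣n = ℤ.∣-trans (ℤ.*-monoˡ-∣ j i∣m) (ℤ.*-monoʳ-∣ m j∣n)

-- The terms 0 < i < q of (1 - Δ)^q. The two end terms are kept apart because their coefficients are
-- 1 and ±1, whereas p divides the others when q is a power of p.
middleTerms : ℕ → Seq → Seq
middleTerms q g x = Σ< (q ∸ 1) (λ i → signedC q (suc i) ℤ.* D (suc i) g x)

-- `∇ q` is 1 - (1 - Δ)^q, and the term i = 0 cancels the 1.
∇-expansion : ∀ q .{{_ : ℕ.NonZero q}} g x →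
  ∇ q g x ≡ ℤ.- (middleTerms q g x ℤ.+ sgn q ℤ.* D q g x)
∇-expansion q@(suc q′) g x = begin
  g x ℤ.- g (x + q)                                ≡⟨ cong (λ y → g x ℤ.- y) (shift-expansion q g x) ⟩
  g x ℤ.- (Σ< q t ℤ.+ t q)                         ≡⟨ cong (λ y → g x ℤ.- (y ℤ.+ t q)) (Σ<-suc q′ t) ⟩
  g x ℤ.- (t 0 ℤ.+ middleTerms q g x ℤ.+ t q)           ≡⟨ cong₂ (λ y z → g x ℤ.- (y ℤ.+ middleTerms q g x ℤ.+ z)) (ℤ.*-identityˡ (g x)) t[q]≡ ⟩
  g x ℤ.- (g x ℤ.+ middleTerms q g x ℤ.+ sgn q ℤ.* D q g x) ≡⟨ lemma (g x) (middleTerms q g x) (sgn q ℤ.* D q g x) ⟩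
  ℤ.- (middleTerms q g x ℤ.+ sgn q ℤ.* D q g x)         ∎
  where
  open ≡-Reasoning
  t : Seq
  t i = signedC q i ℤ.* D i g x
  t[q]≡ : t q ≡ sgn q ℤ.* D q g x
  t[q]≡ = cong (ℤ._* D q g x) (trans (cong (λ c → sgn q ℤ.* + c) (nCn≡1 q)) (ℤ.*-identityʳ (sgn q)))
  lemma : ∀ a b c → a ℤ.- (a ℤ.+ b ℤ.+ c) ≡ ℤ.- (b ℤ.+ c)
  lemma = solve-∀

-- The calculus of weights.

module Weight (p φ : ℕ) where

  -- With Δ of weight 1 and p of weight φ, g has weight at least m; T is the threshold from which a weight w
  -- forces divisibility, by p ^ (1 + ⌊(w - T) / φ⌋).
  Wt : ℕ → ℕ → Seq → Set
  Wt T m g = ∀ j k → φ * j + T ≤ m + k → ∀ x → + (p ^ suc j) ∣ᶻ D k g x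

  module _ {T : ℕ} where

    Wt-cong : ∀ {m g h} → g ≗ h → Wt T m g → Wt T m h
    Wt-cong g≗h wg j k le x = subst (+ (p ^ suc j) ∣ᶻ_) (D-cong k g≗h x) (wg j k le x)

    Wt-weaken : ∀ {m n g} → m ≤ n → Wt T n g → Wt T m g
    Wt-weaken m≤n wg j k le = wg j k (ℕ.≤-trans le (ℕ.+-monoˡ-≤ k m≤n))

    Wt-+ : ∀ {m} g h → Wt T m g → Wt T m h → Wt T m (λ x → g x ℤ.+ h x)
    Wt-+ g h wg wh j k le x = subst (+ (p ^ suc j) ∣ᶻ_) (sym (D-+ k g h x)) (ℤ.∣m∣n⇒∣m+n (wg j k le x) (wh j k le x))

    Wt-* : ∀ {m} c g → Wt T m g → Wt T m (λ x → c ℤ.* g x)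
    Wt-* c g wg j k le x = subst (+ (p ^ suc j) ∣ᶻ_) (sym (D-* k c g x)) (ℤ.∣n⇒∣m*n c (wg j k le x))

    Wt-0 : ∀ {m} → Wt T m (λ _ → 0ℤ)
    Wt-0 j k _ x = subst (+ (p ^ suc j) ∣ᶻ_) (sym (D-* k 0ℤ (λ _ → 0ℤ) x)) (divides 0ℤ refl)

    Wt-Σ< : ∀ {m} n (u : ℕ → Seq) → (∀ i → i < n → Wt T m (u i)) → Wt T m (λ x → Σ< n (λ i → u i x))
    Wt-Σ< zero    u wu = Wt-0
    Wt-Σ< (suc n) u wu = Wt-+ (λ x → Σ< n (λ i → u i x)) (u n) (Wt-Σ< n u λ i i<n → wu i (ℕ.m≤n⇒m≤1+n i<n)) (wu n ℕ.≤-refl)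

    Wt-D : ∀ {m} i g → Wt T m g → Wt T (i + m) (D i g)
    Wt-D {m} i g wg j k le x = subst (λ h → + (p ^ suc j) ∣ᶻ h x) (fold-+ g Δ k)
      (wg j (k + i) (subst (φ * j + T ≤_) (reorder i m k) le) x)
      where
      reorder : ∀ i m k → i + m + k ≡ m + (k + i)
      reorder = ℕSolver.solve-∀

    -- The factor p of `c` lowers `j` by one and so the required weight by `φ`; at `j = 0` it is all
    -- that is wanted.
    Wt-p∣ : ∀ {m c} g → + p ∣ᶻ c → Wt T m g → Wt T (φ + m) (λ x → c ℤ.* g x)
    Wt-p∣ {m} {c} g p∣c wg zero k le x = subst (+ (p * 1) ∣ᶻ_) (sym (D-* k c g x))
      (ℤ.∣m⇒∣m*n (D k g x) (subst (λ p → + p ∣ᶻ c) (sym (ℕ.*-identityʳ p)) p∣c))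
    Wt-p∣ {m} {c} g p∣c wg (suc j) k le x = subst₂ _∣ᶻ_ (sym (ℤ.pos-* p (p ^ suc j))) (sym (D-* k c g x))
      (*-pres-∣ᶻ p∣c (wg j k (ℕ.+-cancelˡ-≤ φ _ _ (subst₂ _≤_ (lhs φ j T) (ℕ.+-assoc φ m k) le)) x))
      where
      lhs : ∀ φ j T → φ * suc j + T ≡ φ + (φ * j + T)
      lhs = ℕSolver.solve-∀

-- Recovering the weight of a function from that of its long difference.

module _ {p : ℕ} (p-prime : Prime p) (b : ℕ) where

  private
    instance
      p≢0 = prime⇒nonZero p-prime
      p>1 = prime⇒nonTrivial p-prime
      q≢0 = ℕ.m^n≢0 p (suc b)
    q φ : ℕ
    q = p ^ suc b
    φ = p ^ b * (p ∸ 1)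

  open Weight p φ

  1≤p∸1 : 1 ≤ p ∸ 1
  1≤p∸1 = ℕ.m<n⇒0<n∸m (ℕ.nonTrivial⇒n>1 p)

  p^b+φ≡q : p ^ b + p ^ b * (p ∸ 1) ≡ p ^ suc b
  p^b+φ≡q = trans (sym (ℕ.*-suc (p ^ b) (p ∸ 1))) (trans (cong (p ^ b *_) (ℕ.suc-pred p)) (ℕ.*-comm (p ^ b) p))

  p^b≤φ : p ^ b ≤ p ^ b * (p ∸ 1)
  p^b≤φ = subst (_≤ φ) (ℕ.*-identityʳ (p ^ b)) (ℕ.*-monoʳ-≤ (p ^ b) 1≤p∸1)

  -- Undoing one `∇ q` costs q in the threshold. Strong induction on `j`: split q differences off
  -- the k given ones and solve `∇-expansion` for the term Δ^q. The term `∇ q` is covered by `w∇`,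
  -- and each middle term gets one or two factors p from C(q, i) and the rest from a smaller `j`.
  Wt-∇⇒Wt : ∀ {T} h → Wt T 0 (∇ q h) → Wt (q + T) 0 h
  Wt-∇⇒Wt {T} h w∇ = <-rec _ step
    where
    Claim : ℕ → Set
    Claim j = ∀ k → φ * j + (q + T) ≤ 0 + k → ∀ x → + (p ^ suc j) ∣ᶻ D k h x
    step : ∀ j → (∀ {i} → i < j → Claim i) → Claim j
    step j rec k le x = subst (λ f → + (p ^ suc j) ∣ᶻ f x) D[q]≡D[k]
      (∣-sgn* q (D q g x) (ℤ.∣m+n∣m⇒∣n (ℤ.∣-trans d∣∇ (ℤ.∣-reflexive -∇≡)) d∣middleTerms))
      where
      k′ = k ∸ q
      q+k′≡k : q + k′ ≡ k
      q+k′≡k = ℕ.m+[n∸m]≡n (ℕ.≤-trans (ℕ.≤-trans (ℕ.m≤m+n q T) (ℕ.m≤n+m (q + T) (φ * j))) le)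
      g = D k′ h
      D[q]≡D[k] : D q g ≡ D k h
      D[q]≡D[k] = trans (sym (fold-+ h Δ q)) (cong (λ k → D k h) q+k′≡k)
      k′-bound : φ * j + T ≤ k′
      k′-bound = ℕ.+-cancelˡ-≤ q _ _ (subst₂ _≤_ (reorder (φ * j) q T) (sym q+k′≡k) le)
        where
        reorder : ∀ a q T → a + (q + T) ≡ q + (a + T)
        reorder = ℕSolver.solve-∀
      -∇≡ : ℤ.- ∇ q g x ≡ middleTerms q g x ℤ.+ sgn q ℤ.* D q g x
      -∇≡ = trans (cong ℤ.-_ (∇-expansion q g x)) (ℤ.neg-involutive _)
      d∣∇ : + (p ^ suc j) ∣ᶻ ℤ.- ∇ q g x
      d∣∇ = ℤ.∣m⇒∣-m (subst (+ (p ^ suc j) ∣ᶻ_) (D-∇ k′ q h x) (w∇ j k′ k′-bound x))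
      d∣middleTerms : + (p ^ suc j) ∣ᶻ middleTerms q g x
      d∣middleTerms = Σ<-∣ (q ∸ 1) λ i i<q∸1 → subst (+ (p ^ suc j) ∣ᶻ_) (sym (ℤ.*-assoc (sgn (suc i)) _ _))
        (ℤ.∣n⇒∣m*n (sgn (suc i)) (term∣ (suc i) (p∣p^[1+b]Ck p-prime b (suc i) (s≤s z≤n)
          (subst (suc (suc i) ≤_) (ℕ.suc-pred q) (s≤s i<q∸1)))))
        where
        rec′ : ∀ {j′} i → j′ < j → φ * j′ + (q + T) ≤ i + k′ → + (p ^ suc j′) ∣ᶻ D i g x
        rec′ {j′} i j′<j le′ = subst (λ f → + (p ^ suc j′) ∣ᶻ f x) (fold-+ h Δ i) (rec j′<j (i + k′) le′ x)
        term∣ : ∀ i → p * p ∣ q C i ⊎ p ∣ q C i × p ^ b ≤ i → + (p ^ suc j) ∣ᶻ + (q C i) ℤ.* D i g x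
        term∣ i = p^∣C*D j i x k′-bound (rec′ i)
          where
          p^∣C*D : ∀ j i x → φ * j + T ≤ k′ →
            (∀ {j′} → j′ < j → φ * j′ + (q + T) ≤ i + k′ → + (p ^ suc j′) ∣ᶻ D i g x) →
            p * p ∣ q C i ⊎ p ∣ q C i × p ^ b ≤ i → + (p ^ suc j) ∣ᶻ + (q C i) ℤ.* D i g x
          p^∣C*D zero i x le rec (inj₂ (p∣C , _)) =
            ℤ.∣m⇒∣m*n (D i g x) (∣⇒∣ᶻ (subst (_∣ q C i) (sym (ℕ.*-identityʳ p)) p∣C))
          p^∣C*D zero i x le rec (inj₁ p²∣C) =
            ℤ.∣m⇒∣m*n (D i g x) (∣⇒∣ᶻ (subst (_∣ q C i) (sym (ℕ.*-identityʳ p)) (∣-trans (m∣m*n p) p²∣C)))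
          -- One factor p comes from C(q, i). Going down to `j` frees `φ`, and i ≥ p ^ b supplies
          -- the rest of q = p ^ b + φ.
          p^∣C*D (suc j) i x le rec (inj₂ (p∣C , p^b≤i)) = subst (_∣ᶻ + (q C i) ℤ.* D i g x) (sym (ℤ.pos-* p (p ^ suc j)))
            (*-pres-∣ᶻ (∣⇒∣ᶻ p∣C) (rec (ℕ.n<1+n j) (ℕ.≤-trans (ℕ.≤-reflexive (trans
              (cong (λ q → φ * j + (q + T)) (sym p^b+φ≡q)) (reorder (p ^ b) φ j T))) (ℕ.+-mono-≤ p^b≤i le))))
            where
            reorder : ∀ r φ j T → φ * j + (r + φ + T) ≡ r + (φ * suc j + T)
            reorder = ℕSolver.solve-∀
          p^∣C*D (suc zero) i x le rec (inj₁ p²∣C) =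
            ℤ.∣m⇒∣m*n (D i g x) (∣⇒∣ᶻ (subst (λ m → p * m ∣ q C i) (sym (ℕ.*-identityʳ p)) p²∣C))
          -- Two factors p come from C(q, i). Going down by two frees 2φ, which is at least q since
          -- p ^ b ≤ φ.
          p^∣C*D (suc (suc j)) i x le rec (inj₁ p²∣C) = subst (_∣ᶻ + (q C i) ℤ.* D i g x)
            (trans (sym (ℤ.pos-* (p * p) (p ^ suc j))) (cong +_ (ℕ.*-assoc p p (p ^ suc j))))
            (*-pres-∣ᶻ (∣⇒∣ᶻ p²∣C) (rec (ℕ.m≤n⇒m≤1+n (ℕ.n<1+n j)) (ℕ.≤-trans (ℕ.≤-trans (ℕ.≤-trans
              (ℕ.+-monoʳ-≤ (φ * j) (ℕ.+-monoˡ-≤ T (ℕ.≤-trans (ℕ.≤-reflexive (sym p^b+φ≡q)) (ℕ.+-monoˡ-≤ φ p^b≤φ))))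
              (ℕ.≤-reflexive (reorder φ j T))) le) (ℕ.m≤n+m k′ i))))
            where
            reorder : ∀ φ j T → φ * j + (φ + φ + T) ≡ φ * suc (suc j) + T
            reorder = ℕSolver.solve-∀

-- Comparison of the powers of `∇ p` with those of Δ^p.

sgn-parity : ∀ n → 2 ∣ n × sgn n ≡ + 1 ⊎ 2 ∣ suc n × sgn n ≡ ℤ.- + 1
sgn-parity zero    = inj₁ (2 ∣0 , refl)
sgn-parity (suc n) with sgn-parity n
... | inj₁ (2∣n , sgn≡1)    = inj₂ (∣m∣n⇒∣m+n ∣-refl 2∣n , cong ℤ.-_ sgn≡1)
... | inj₂ (2∣1+n , sgn≡-1) = inj₁ (2∣1+n , cong ℤ.-_ sgn≡-1)

-- The sum is 0 for odd p and 2 for p = 2. It is, up to sign, the coefficient of Δ^p in `∇ p` - Δ^p.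
prime∣1+sgn : ∀ {p} → Prime p → + p ∣ᶻ + 1 ℤ.+ sgn p
prime∣1+sgn {p} p-prime with sgn-parity p
... | inj₂ (_ , sgn≡-1) = subst (λ s → + p ∣ᶻ + 1 ℤ.+ s) (sym sgn≡-1) (divides 0ℤ refl)
... | inj₁ (2∣p , sgn≡1) with prime⇒irreducible p-prime 2∣p
...   | inj₁ ()
...   | inj₂ refl = divides (+ 1) refl

prime∣pCk : ∀ {p} → Prime p → ∀ k → 0 < k → k < p → p ∣ p C k
prime∣pCk {p} p-prime k 0<k k<p
  with subst (λ q → p * p ∣ q C k ⊎ p ∣ q C k × 1 ≤ k) (ℕ.*-identityʳ p)
         (p∣p^[1+b]Ck p-prime 0 k 0<k (subst (k <_) (sym (ℕ.*-identityʳ p)) k<p))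
... | inj₁ p²∣C     = ∣-trans (m∣m*n p) p²∣C
... | inj₂ (p∣C , _) = p∣C

∇-+ : ∀ h f g x → ∇ h (λ y → f y ℤ.+ g y) x ≡ ∇ h f x ℤ.+ ∇ h g x
∇-+ h f g x = lemma (f x) (f (x + h)) (g x) (g (x + h))
  where
  lemma : ∀ a b c d → a ℤ.+ c ℤ.- (b ℤ.+ d) ≡ a ℤ.- b ℤ.+ (c ℤ.- d)
  lemma = solve-∀

-- The operator E of the overview.
defect : ℕ → Seq → Seq
defect p g x = ∇ p g x ℤ.- D p g x

∇-defect : ∀ p g x → ∇ p g x ≡ D p g x ℤ.+ defect p g x
∇-defect p g x = lemma (∇ p g x) (D p g x)
  where
  lemma : ∀ a b → a ≡ b ℤ.+ (a ℤ.- b)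
  lemma = solve-∀

defect-D : ∀ p n g x → defect p (D n g) x ≡ D n (defect p g) x
defect-D p n g x = sym (begin
  D n (defect p g) x ≡⟨ D-+ n (∇ p g) (λ y → ℤ.- D p g y) x ⟩
  D n (∇ p g) x ℤ.+ D n (λ y → ℤ.- D p g y) x
    ≡⟨ cong₂ ℤ._+_ (D-∇ n p g x) (trans (D-cong n (λ y → sym (ℤ.-1*i≡-i (D p g y))) x)
         (trans (D-* n (ℤ.- + 1) (D p g) x) (ℤ.-1*i≡-i _))) ⟩
  ∇ p (D n g) x ℤ.- D n (D p g) x ≡⟨ cong (λ h → ∇ p (D n g) x ℤ.- h x) D-comm ⟩
  defect p (D n g) x ∎)
  where
  open ≡-Reasoning
  D-comm : D n (D p g) ≡ D p (D n g)
  D-comm = trans (sym (fold-+ g Δ n)) (trans (cong (fold g Δ) (ℕ.+-comm n p)) (fold-+ g Δ p))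

module _ {p : ℕ} (p-prime : Prime p) (φ T : ℕ) where

  open Weight p φ

  private
    instance
      p≢0 = prime⇒nonZero p-prime
    ∇^ : ℕ → Seq → Seq
    ∇^ n f = fold f (∇ p) n

  -- In E every coefficient is divisible by p, which gives `φ`, and every term contains at least one
  -- Δ, which gives 1 more.
  Wt-defect : ∀ {m} g → Wt T m g → Wt T (suc φ + m) (defect p g)
  Wt-defect {m} g wg = Wt-cong (λ x → sym (defect≡ x))
    (Wt-+ (λ x → ℤ.- + 1 ℤ.* middleTerms p g x) (λ x → ℤ.- (+ 1 ℤ.+ sgn p) ℤ.* D p g x)
      (Wt-* (ℤ.- + 1) (middleTerms p g) (Wt-Σ< (p ∸ 1) (λ i x → signedC p (suc i) ℤ.* D (suc i) g x) λ i i<p∸1 →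
        Wt-weaken (weaken φ (suc i) m (s≤s z≤n))
          (Wt-p∣ (D (suc i) g)
            (ℤ.∣n⇒∣m*n (sgn (suc i)) (∣⇒∣ᶻ (prime∣pCk p-prime (suc i) (s≤s z≤n) (subst (suc (suc i) ≤_) (ℕ.suc-pred p) (s≤s i<p∸1)))))
            (Wt-D (suc i) g wg))))
      (Wt-weaken (weaken φ p m (ℕ.>-nonZero⁻¹ p))
        (Wt-p∣ (D p g) (ℤ.∣m⇒∣-m (prime∣1+sgn p-prime)) (Wt-D p g wg))))
    where
    weaken : ∀ φ i m → 1 ≤ i → suc φ + m ≤ φ + (i + m)
    weaken φ i m 1≤i = ℕ.≤-trans (ℕ.≤-reflexive (sym (ℕ.+-suc φ m))) (ℕ.+-monoʳ-≤ φ (ℕ.+-monoˡ-≤ m 1≤i))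
    defect≡ : ∀ x → defect p g x ≡ ℤ.- + 1 ℤ.* middleTerms p g x ℤ.+ ℤ.- (+ 1 ℤ.+ sgn p) ℤ.* D p g x
    defect≡ x = trans (cong (ℤ._- D p g x) (∇-expansion p g x)) (lemma (middleTerms p g x) (sgn p) (D p g x))
      where
      lemma : ∀ a s b → ℤ.- (a ℤ.+ s ℤ.* b) ℤ.- b ≡ ℤ.- + 1 ℤ.* a ℤ.+ ℤ.- (+ 1 ℤ.+ s) ℤ.* b
      lemma = solve-∀

  Wt-∇ : ∀ {m} g → p ≤ suc φ → Wt T m g → Wt T (p + m) (∇ p g)
  Wt-∇ {m} g p≤1+φ wg = Wt-cong (λ x → sym (∇-defect p g x))
    (Wt-+ (D p g) (defect p g) (Wt-D p g wg) (Wt-weaken (ℕ.+-monoˡ-≤ m p≤1+φ) (Wt-defect g wg)))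

  -- For n = m + 1, the part of (Δ^p + E)ⁿ that is linear in E, and the part of order at least two
  -- in E. Indexing by n - 1 avoids truncated subtraction in the exponent of Δ.
  linearPart remainder : Seq → ℕ → Seq
  linearPart f m x = + suc m ℤ.* D (m * p) (defect p f) x
  remainder f m x = ∇^ (suc m) f x ℤ.- (D (suc m * p) f x ℤ.+ linearPart f m x)

  ∇^≡ : ∀ f m x → ∇^ (suc m) f x ≡ D (suc m * p) f x ℤ.+ linearPart f m x ℤ.+ remainder f m x
  ∇^≡ f m x = lemma (∇^ (suc m) f x) (D (suc m * p) f x ℤ.+ linearPart f m x)
    where
    lemma : ∀ a b → a ≡ b ℤ.+ (a ℤ.- b)
    lemma = solve-∀

  remainder-zero : ∀ f x → remainder f 0 x ≡ 0ℤ
  remainder-zero f x = trans (cong (λ n → ∇ p f x ℤ.- (D n f x ℤ.+ + 1 ℤ.* defect p f x)) (ℕ.+-identityʳ p))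
    (lemma (∇ p f x) (D p f x))
    where
    lemma : ∀ a b → a ℤ.- (b ℤ.+ + 1 ℤ.* (a ℤ.- b)) ≡ 0ℤ
    lemma = solve-∀

  -- Apply Δ^p + E to each of the three parts. The pure power and the linear part together yield the
  -- next pure power, the next linear part and one new quadratic term, (m + 1) Δ^(mp) E².
  remainder-suc : ∀ f m x → remainder f (suc m) x ≡
    + suc m ℤ.* D (m * p) (defect p (defect p f)) x ℤ.+ ∇ p (remainder f m) x
  remainder-suc f m x = begin
    ∇ p (∇^ (suc m) f) x ℤ.- Z
      ≡⟨ cong (ℤ._- Z) (cong₂ ℤ._-_ (∇^≡ f m x) (∇^≡ f m (x + p))) ⟩
    ∇ p (λ y → A y ℤ.+ linearPart f m y ℤ.+ remainder f m y) x ℤ.- Z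
      ≡⟨ cong (ℤ._- Z) (∇-+ p (λ y → A y ℤ.+ linearPart f m y) (remainder f m) x) ⟩
    ∇ p (λ y → A y ℤ.+ linearPart f m y) x ℤ.+ ∇ p (remainder f m) x ℤ.- Z
      ≡⟨ cong (λ z → z ℤ.+ ∇ p (remainder f m) x ℤ.- Z) (trans (∇-+ p A (linearPart f m) x)
           (cong₂ ℤ._+_ ∇A≡ ∇lin≡)) ⟩
    D n f x ℤ.+ B ℤ.+ c ℤ.* (B ℤ.+ C′) ℤ.+ ∇ p (remainder f m) x ℤ.- (D n f x ℤ.+ + suc (suc m) ℤ.* B)
      ≡⟨ cong (λ e → D n f x ℤ.+ B ℤ.+ c ℤ.* (B ℤ.+ C′) ℤ.+ ∇ p (remainder f m) x ℤ.- (D n f x ℤ.+ e ℤ.* B)) (ℤ.pos-+ 1 (suc m)) ⟩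
    D n f x ℤ.+ B ℤ.+ c ℤ.* (B ℤ.+ C′) ℤ.+ ∇ p (remainder f m) x ℤ.- (D n f x ℤ.+ (+ 1 ℤ.+ c) ℤ.* B)
      ≡⟨ lemma (D n f x) B c C′ (∇ p (remainder f m) x) ⟩
    c ℤ.* C′ ℤ.+ ∇ p (remainder f m) x ∎
    where
    open ≡-Reasoning
    n = suc (suc m) * p
    c = + suc m
    A : Seq
    A = D (suc m * p) f
    B C′ Z : ℤ
    B = D (suc m * p) (defect p f) x
    C′ = D (m * p) (defect p (defect p f)) x
    Z = D n f x ℤ.+ linearPart f (suc m) x
    ∇A≡ : ∇ p A x ≡ D n f x ℤ.+ B
    ∇A≡ = trans (∇-defect p A x) (cong₂ ℤ._+_ (cong (λ h → h x) (sym (fold-+ f Δ p))) (defect-D p (suc m * p) f x))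
    ∇lin≡ : ∇ p (linearPart f m) x ≡ c ℤ.* (B ℤ.+ C′)
    ∇lin≡ = trans (factor c (D (m * p) (defect p f) x) _) (cong (c ℤ.*_) (trans (∇-defect p (D (m * p) (defect p f)) x)
      (cong₂ ℤ._+_ (cong (λ h → h x) (sym (fold-+ (defect p f) Δ p))) (defect-D p (m * p) (defect p f) x))))
      where
      factor : ∀ c a b → c ℤ.* a ℤ.- c ℤ.* b ≡ c ℤ.* (a ℤ.- b)
      factor = solve-∀
    lemma : ∀ a b c d e → a ℤ.+ b ℤ.+ c ℤ.* (b ℤ.+ d) ℤ.+ e ℤ.- (a ℤ.+ (+ 1 ℤ.+ c) ℤ.* b) ≡ c ℤ.* d ℤ.+ e
    lemma = solve-∀

  -- d = φ + 1 - p is what defect gains over D p; it counts twice because the remainder is quadratic in defect.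
  Wt-remainder : ∀ {d} f → suc φ ≡ p + d → Wt T 0 f → ∀ m → Wt T (suc m * p + (d + d)) (remainder f m)
  Wt-remainder {d} f 1+φ≡p+d wf zero    = Wt-cong (λ x → sym (remainder-zero f x)) Wt-0
  Wt-remainder {d} f 1+φ≡p+d wf (suc m) = Wt-cong (λ x → sym (remainder-suc f m x))
    (Wt-+ (λ x → + suc m ℤ.* D (m * p) (defect p (defect p f)) x) (∇ p (remainder f m))
      (Wt-* (+ suc m) (D (m * p) (defect p (defect p f)))
        (Wt-weaken (ℕ.≤-reflexive weight≡) (Wt-D (m * p) (defect p (defect p f)) (Wt-defect (defect p f) (Wt-defect f wf)))))
      (Wt-weaken (ℕ.≤-reflexive (ℕ.+-assoc p (suc m * p) (d + d))) (Wt-∇ (remainder f m) p≤1+φ (Wt-remainder f 1+φ≡p+d wf m))))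
    where
    p≤1+φ = ℕ.≤-trans (ℕ.m≤m+n p d) (ℕ.≤-reflexive (sym 1+φ≡p+d))
    weight≡ : suc (suc m) * p + (d + d) ≡ m * p + (suc φ + (suc φ + 0))
    weight≡ = trans (reorder m p d) (cong (λ e → m * p + (e + (e + 0))) (sym 1+φ≡p+d))
      where
      reorder : ∀ m p d → suc (suc m) * p + (d + d) ≡ m * p + (p + d + (p + d + 0))
      reorder = ℕSolver.solve-∀

-- The congruence between Δ^(s + pn) and Δ^s (∇ p)ⁿ.

module _ {p : ℕ} (p-prime : Prime p) where

  private instance
    p≢0 = prime⇒nonZero p-prime

  -- Here `φ₀` and `p * φ₀` stand for the totients at the lower and upper level. Multiplied by p,
  -- the bound on `n` shows that weight pn + φ suffices for p ^ (e + 1). The remainder has it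
  -- because 2d ≥ φ; the linear part, of weight pn + φ - (p - 1), is treated according to whether p
  -- divides n.
  ∇^-congruence : ∀ {φ₀ U₀} f → p ∣ φ₀ → p ∣ U₀ → p + p ≤ p * φ₀ →
    Weight.Wt p (p * φ₀) (p * U₀ + p * φ₀) 0 f →
    ∀ n s e → φ₀ * e + U₀ ≤ n → + (p ^ suc e) ∣ᶻ D (s + n * p) f 0 ℤ.- D s (fold f (∇ p) n) 0
  ∇^-congruence {φ₀} {U₀} f p∣φ₀ p∣U₀ 2p≤φ wf zero s e le = divides 0ℤ
    (trans (cong (λ m → D m f 0 ℤ.- D s f 0) (ℕ.+-identityʳ s)) (ℤ.+-inverseʳ (D s f 0)))
  ∇^-congruence {φ₀} {U₀} f p∣φ₀ p∣U₀ 2p≤φ wf (suc m) s e le =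
    subst (+ (p ^ suc e) ∣ᶻ_) (sym difference≡)
      (ℤ.∣m⇒∣-m (ℤ.∣m∣n⇒∣m+n linear∣ (Wt-D s (remainder p-prime φ T f m) (Wt-remainder p-prime φ T f 1+φ≡p+d wf m) e 0 remainder-bound 0)))
    where
    φ = p * φ₀
    T = p * U₀ + φ
    d = suc φ ∸ p
    open Weight p φ
    1+φ≡p+d : suc φ ≡ p + d
    1+φ≡p+d = sym (ℕ.m+[n∸m]≡n (ℕ.≤-trans (ℕ.m≤m+n p p) (ℕ.m≤n⇒m≤1+n 2p≤φ)))
    A L R : Seq
    A = D (suc m * p) f
    L = linearPart p-prime φ T f m
    R = remainder p-prime φ T f m
    scaled-bound : p * (φ₀ * e + U₀) ≤ suc m * p
    scaled-bound = ℕ.≤-trans (ℕ.*-monoʳ-≤ p le) (ℕ.≤-reflexive (ℕ.*-comm p (suc m)))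
    target≡ : φ * e + T ≡ p * (φ₀ * e + U₀) + φ
    target≡ = reorder p φ₀ e U₀
      where
      reorder : ∀ p φ₀ e U₀ → p * φ₀ * e + (p * U₀ + p * φ₀) ≡ p * (φ₀ * e + U₀) + p * φ₀
      reorder = ℕSolver.solve-∀
    -- Add 2p on both sides: 2p + φ ≤ 2φ ≤ 2(φ + 1) = 2p + 2d.
    φ≤2d : φ ≤ d + d
    φ≤2d = ℕ.+-cancelˡ-≤ (p + p) φ (d + d) (begin
      p + p + φ         ≤⟨ ℕ.+-monoˡ-≤ φ 2p≤φ ⟩
      φ + φ             ≤⟨ ℕ.+-mono-≤ (ℕ.n≤1+n φ) (ℕ.n≤1+n φ) ⟩
      suc φ + suc φ     ≡⟨ cong₂ _+_ 1+φ≡p+d 1+φ≡p+d ⟩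
      p + d + (p + d)   ≡⟨ reorder p d ⟩
      p + p + (d + d)   ∎)
      where
      open ℕ.≤-Reasoning
      reorder : ∀ p d → p + d + (p + d) ≡ p + p + (d + d)
      reorder = ℕSolver.solve-∀
    p≤1+φ : p ≤ suc φ
    p≤1+φ = ℕ.≤-trans (ℕ.m≤m+n p d) (ℕ.≤-reflexive (sym 1+φ≡p+d))
    remainder-bound : φ * e + T ≤ s + (suc m * p + (d + d)) + 0
    remainder-bound = begin
      φ * e + T                           ≡⟨ target≡ ⟩
      p * (φ₀ * e + U₀) + φ               ≤⟨ ℕ.+-mono-≤ scaled-bound φ≤2d ⟩
      suc m * p + (d + d)                 ≤⟨ ℕ.m≤n+m _ s ⟩
      s + (suc m * p + (d + d))           ≡⟨ ℕ.+-identityʳ _ ⟨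
      s + (suc m * p + (d + d)) + 0       ∎
      where open ℕ.≤-Reasoning
    Wt-linear : Wt T (m * p + (suc φ + 0)) (D (m * p) (defect p f))
    Wt-linear = Wt-D (m * p) (defect p f) (Wt-defect p-prime φ T f wf)
    linear∣ : + (p ^ suc e) ∣ᶻ D s L 0
    linear∣ with p ∣? suc m
    -- The coefficient n of the linear part contributes another `φ`, and φ ≥ p - 1 makes up the
    -- shortfall.
    ... | yes p∣n = Wt-D s L (Wt-p∣ (D (m * p) (defect p f)) (∣⇒∣ᶻ p∣n) Wt-linear) e 0 bound 0
      where
      bound : φ * e + T ≤ s + (φ + (m * p + (suc φ + 0))) + 0
      bound = begin
        φ * e + T                           ≡⟨ target≡ ⟩
        p * (φ₀ * e + U₀) + φ               ≤⟨ ℕ.+-monoˡ-≤ φ scaled-bound ⟩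
        p + m * p + φ                       ≤⟨ ℕ.+-monoˡ-≤ φ (ℕ.+-monoˡ-≤ (m * p) p≤1+φ) ⟩
        suc φ + m * p + φ                   ≤⟨ ℕ.m≤n+m _ s ⟩
        s + (suc φ + m * p + φ)             ≡⟨ reorder s φ (m * p) ⟩
        s + (φ + (m * p + (suc φ + 0))) + 0 ∎
        where
        open ℕ.≤-Reasoning
        reorder : ∀ s φ k → s + (suc φ + k + φ) ≡ s + (φ + (k + (suc φ + 0))) + 0
        reorder = ℕSolver.solve-∀
    ... | no  p∤n = Wt-D s L (Wt-* (+ suc m) (D (m * p) (defect p f)) Wt-linear) e 0 bound 0
      where
      -- p divides the left-hand side but not n = suc m, so the inequality is strict
      le< : suc (φ₀ * e + U₀) ≤ suc m
      le< = ℕ.≤∧≢⇒< le λ eq → p∤n (subst (p ∣_) eq (∣m∣n⇒∣m+n (∣m⇒∣m*n e p∣φ₀) p∣U₀))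
      bound : φ * e + T ≤ s + (m * p + (suc φ + 0)) + 0
      bound = begin
        φ * e + T                     ≡⟨ target≡ ⟩
        p * (φ₀ * e + U₀) + φ         ≤⟨ ℕ.+-mono-≤ (ℕ.*-monoʳ-≤ p (ℕ.s≤s⁻¹ le<)) (ℕ.n≤1+n φ) ⟩
        p * m + suc φ                 ≤⟨ ℕ.m≤n+m _ s ⟩
        s + (p * m + suc φ)           ≡⟨ reorder s φ m p ⟩
        s + (m * p + (suc φ + 0)) + 0 ∎
        where
        open ℕ.≤-Reasoning
        reorder : ∀ s φ m p → s + (p * m + suc φ) ≡ s + (m * p + (suc φ + 0)) + 0
        reorder = ℕSolver.solve-∀
    difference≡ : D (s + suc m * p) f 0 ℤ.- D s (fold f (∇ p) (suc m)) 0 ≡ ℤ.- (D s L 0 ℤ.+ D s R 0)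
    difference≡ = trans (cong₂ ℤ._-_ (cong (λ h → h 0) (fold-+ f Δ s))
      (trans (D-cong s (∇^≡ p-prime φ T f m) 0)
        (trans (D-+ s (λ x → A x ℤ.+ L x) R 0) (cong (ℤ._+ D s R 0) (D-+ s A L 0)))))
      (lemma (D s A 0) (D s L 0) (D s R 0))
      where
      lemma : ∀ a b c → a ℤ.- (a ℤ.+ b ℤ.+ c) ≡ ℤ.- (b ℤ.+ c)
      lemma = solve-∀

-- Floor division and its uniqueness.

÷-division : ∀ x d .{{_ : ℕ.NonZero d}} → x ≡ + (x %ℕ d) ℤ.+ (x ÷ d) ℤ.* + d
÷-division x d@(suc _) = trans (a≡a%ℕn+[a/ℕn]*n x d) (cong (λ y → + (x %ℕ d) ℤ.+ y ℤ.* + d) (sym (div-pos-is-/ℕ x d)))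

-- Since x d ≤ r + x d = r′ + y d < (y + 1) d. Used in both directions, it gives uniqueness of the
-- quotient.
quotient-≤ : ∀ {r r′ d} x y .{{_ : ℕ.NonZero d}} → r′ < d →
  + r ℤ.+ x ℤ.* + d ≡ + r′ ℤ.+ y ℤ.* + d → x ℤ.≤ y
quotient-≤ {r} {r′} {d} x y r′<d eq = subst₂ ℤ._≤_ (ℤ.pred-suc x) (ℤ.pred-suc y) (ℤ.pred-mono (ℤ.i<j⇒suc[i]≤j x<1+y))
  where
  open ℤ.≤-Reasoning
  x<1+y : x ℤ.< ℤ.suc y
  x<1+y = ℤ.*-cancelʳ-<-nonNeg (+ d) (begin-strict
    x ℤ.* + d            ≤⟨ ℤ.i≤j+i (x ℤ.* + d) (+ r) ⟩
    + r ℤ.+ x ℤ.* + d    ≡⟨ eq ⟩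
    + r′ ℤ.+ y ℤ.* + d   <⟨ ℤ.+-monoˡ-< (y ℤ.* + d) (ℤ.+<+ r′<d) ⟩
    + d ℤ.+ y ℤ.* + d    ≡⟨ ℤ.suc-* y (+ d) ⟨
    ℤ.suc y ℤ.* + d      ∎)

÷-unique : ∀ {r d} x y .{{_ : ℕ.NonZero d}} → r < d → x ≡ + r ℤ.+ y ℤ.* + d → x ÷ d ≡ y
÷-unique {r} {d} x y r<d eq = ℤ.≤-antisym
  (quotient-≤ (x ÷ d) y r<d (trans (sym (÷-division x d)) eq))
  (quotient-≤ y (x ÷ d) (n%ℕd<d x d) (trans (sym eq) (÷-division x d)))

÷-exact : ∀ {x} y d .{{_ : ℕ.NonZero d}} → x ≡ y ℤ.* + d → x ÷ d ≡ y
÷-exact {x} y d eq = ÷-unique x y (ℕ.>-nonZero⁻¹ d) (trans eq (sym (ℤ.+-identityˡ _)))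

-- Binomial coefficients with an integer upper argument.

falling-shift : ∀ x l → falling (x ℤ.+ + 1) (suc l) ≡ (x ℤ.+ + 1) ℤ.* falling x l
falling-shift x zero    = lemma x
  where
  lemma : ∀ x → + 1 ℤ.* (x ℤ.+ + 1 ℤ.- 0ℤ) ≡ (x ℤ.+ + 1) ℤ.* + 1
  lemma = solve-∀
falling-shift x (suc l) = trans
  (cong₂ (λ a b → a ℤ.* (x ℤ.+ + 1 ℤ.- b)) (falling-shift x l) (ℤ.pos-+ 1 l))
  (lemma x (falling x l) (+ l))
  where
  lemma : ∀ x f l → (x ℤ.+ + 1) ℤ.* f ℤ.* (x ℤ.+ + 1 ℤ.- (+ 1 ℤ.+ l)) ≡ (x ℤ.+ + 1) ℤ.* (f ℤ.* (x ℤ.- l))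
  lemma = solve-∀

-- Pascal's rule multiplied by (l + 1)!, so that it can be proved before the divisibility by
-- factorials.
falling-pascal : ∀ x l → falling (x ℤ.+ + 1) (suc l) ≡ falling x (suc l) ℤ.+ + suc l ℤ.* falling x l
falling-pascal x l = trans (falling-shift x l) (trans (lemma x (falling x l) (+ l))
  (cong (λ y → falling x (suc l) ℤ.+ y ℤ.* falling x l) (sym (ℤ.pos-+ 1 l))))
  where
  lemma : ∀ x f l → (x ℤ.+ + 1) ℤ.* f ≡ f ℤ.* (x ℤ.- l) ℤ.+ (+ 1 ℤ.+ l) ℤ.* f
  lemma = solve-∀

-- Induction on `l`. For l + 1, the cleared Pascal rule carries divisibility from x to x + 1 and
-- back, starting at x = 0, where the product vanishes.
!∣falling : ∀ l x → + (l !) ∣ᶻ falling x l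
!∣falling zero    x = divides (+ 1) refl
!∣falling (suc l) x = go x
  where
  d∣[1+l]*falling : ∀ x → + (suc l !) ∣ᶻ + suc l ℤ.* falling x l
  d∣[1+l]*falling x = subst (_∣ᶻ + suc l ℤ.* falling x l) (sym (ℤ.pos-* (suc l) (l !))) (ℤ.*-monoʳ-∣ (+ suc l) (!∣falling l x))
  up : ∀ {x y} → x ℤ.+ + 1 ≡ y → + (suc l !) ∣ᶻ falling x (suc l) → + (suc l !) ∣ᶻ falling y (suc l)
  up {x} refl d∣ = subst (+ (suc l !) ∣ᶻ_) (sym (falling-pascal x l)) (ℤ.∣m∣n⇒∣m+n d∣ (d∣[1+l]*falling x))
  down : ∀ {x y} → x ℤ.+ + 1 ≡ y → + (suc l !) ∣ᶻ falling y (suc l) → + (suc l !) ∣ᶻ falling x (suc l)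
  down {x} refl d∣ = ℤ.∣m+n∣n⇒∣m (subst (+ (suc l !) ∣ᶻ_) (falling-pascal x l) d∣) (d∣[1+l]*falling x)
  go : ∀ x → + (suc l !) ∣ᶻ falling x (suc l)
  go (+ zero)     = subst (+ (suc l !) ∣ᶻ_) (sym (falling-shift (ℤ.- + 1) l)) (divides 0ℤ refl)
  go (+ suc n)    = up (cong +_ (ℕ.+-comm n 1)) (go (+ n))
  go -[1+ zero ]  = down refl (go (+ 0))
  go -[1+ suc n ] = down refl (go -[1+ n ])

binomℤ*! : ∀ x l → binomℤ x l ℤ.* + (l !) ≡ falling x l
binomℤ*! x l with !∣falling l x
... | divides y eq = trans (cong (ℤ._* + (l !)) (÷-exact y (l !) {{l ℕ.!≢0}} eq)) (sym eq)

binomℤ-pascal : ∀ x l → binomℤ (x ℤ.+ + 1) (suc l) ≡ binomℤ x (suc l) ℤ.+ binomℤ x l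
binomℤ-pascal x l = ℤ.*-cancelʳ-≡ _ _ (+ (suc l !)) {{suc l ℕ.!≢0}} (begin
  binomℤ (x ℤ.+ + 1) (suc l) ℤ.* + (suc l !)       ≡⟨ binomℤ*! (x ℤ.+ + 1) (suc l) ⟩
  falling (x ℤ.+ + 1) (suc l)                      ≡⟨ falling-pascal x l ⟩
  falling x (suc l) ℤ.+ + suc l ℤ.* falling x l
    ≡⟨ cong₂ (λ a b → a ℤ.+ + suc l ℤ.* b) (binomℤ*! x (suc l)) (binomℤ*! x l) ⟨
  binomℤ x (suc l) ℤ.* + (suc l !) ℤ.+ + suc l ℤ.* (binomℤ x l ℤ.* + (l !))
    ≡⟨ cong (λ a → binomℤ x (suc l) ℤ.* a ℤ.+ + suc l ℤ.* (binomℤ x l ℤ.* + (l !))) (ℤ.pos-* (suc l) (l !)) ⟩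
  binomℤ x (suc l) ℤ.* (+ suc l ℤ.* + (l !)) ℤ.+ + suc l ℤ.* (binomℤ x l ℤ.* + (l !))
    ≡⟨ lemma (binomℤ x (suc l)) (binomℤ x l) (+ suc l) (+ (l !)) ⟩
  (binomℤ x (suc l) ℤ.+ binomℤ x l) ℤ.* (+ suc l ℤ.* + (l !))
    ≡⟨ cong ((binomℤ x (suc l) ℤ.+ binomℤ x l) ℤ.*_) (ℤ.pos-* (suc l) (l !)) ⟨
  (binomℤ x (suc l) ℤ.+ binomℤ x l) ℤ.* + (suc l !) ∎)
  where
  open ≡-Reasoning
  lemma : ∀ a b c d → a ℤ.* (c ℤ.* d) ℤ.+ c ℤ.* (b ℤ.* d) ≡ (a ℤ.+ b) ℤ.* (c ℤ.* d)
  lemma = solve-∀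

-- The function f of the overview, and its weight.

kernel : ℤ → ℕ → ℕ → Seq
kernel r l q k = if does ((+ q) ∣ᶻ? (+ k ℤ.- r)) then binomℤ ((+ k ℤ.- r) ÷ q) l else 0ℤ

kernel-∣ : ∀ r l q .{{_ : ℕ.NonZero q}} k y → + k ℤ.- r ≡ y ℤ.* + q → kernel r l q k ≡ binomℤ y l
kernel-∣ r l q k y eq = trans
  (cong (if_then binomℤ ((+ k ℤ.- r) ÷ q) l else 0ℤ) (dec-true ((+ q) ∣ᶻ? (+ k ℤ.- r)) (divides y eq)))
  (cong (λ y → binomℤ y l) (÷-exact y q eq))

kernel-∤ : ∀ r l q k → ¬ + q ∣ᶻ + k ℤ.- r → kernel r l q k ≡ 0ℤ
kernel-∤ r l q k q∤ =
  cong (if_then binomℤ ((+ k ℤ.- r) ÷ q) l else 0ℤ) (dec-false ((+ q) ∣ᶻ? (+ k ℤ.- r)) q∤)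

module _ (r : ℤ) (q : ℕ) .{{_ : ℕ.NonZero q}} where

  shift≡ : ∀ k → + (k + q) ℤ.- r ≡ (+ k ℤ.- r) ℤ.+ + q
  shift≡ k = trans (cong (ℤ._- r) (ℤ.pos-+ k q)) (lemma (+ k) (+ q) r)
    where
    lemma : ∀ k q r → k ℤ.+ q ℤ.- r ≡ k ℤ.- r ℤ.+ q
    lemma = solve-∀

  ∤-shift : ∀ k → ¬ + q ∣ᶻ + k ℤ.- r → ¬ + q ∣ᶻ + (k + q) ℤ.- r
  ∤-shift k q∤ q∣ = q∤ (ℤ.∣m+n∣n⇒∣m (subst (+ q ∣ᶻ_) (shift≡ k) q∣) ℤ.∣-refl)

  kernel-shift : ∀ l k y → + k ℤ.- r ≡ y ℤ.* + q → kernel r l q (k + q) ≡ binomℤ (y ℤ.+ + 1) l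
  kernel-shift l k y eq = kernel-∣ r l q (k + q) (y ℤ.+ + 1)
    (trans (shift≡ k) (trans (cong (ℤ._+ + q) eq) (lemma y (+ q))))
    where
    lemma : ∀ y q → y ℤ.* q ℤ.+ q ≡ (y ℤ.+ + 1) ℤ.* q
    lemma = solve-∀

  ∇-kernel-zero : ∀ k → 0ℤ ≡ ∇ q (kernel r 0 q) k
  ∇-kernel-zero k with (+ q) ∣ᶻ? (+ k ℤ.- r)
  ... | yes (divides y eq) = sym (cong₂ ℤ._-_ (kernel-∣ r 0 q k y eq) (kernel-shift 0 k y eq))
  ... | no q∤              = sym (cong₂ ℤ._-_ (kernel-∤ r 0 q k q∤) (kernel-∤ r 0 q (k + q) (∤-shift k q∤)))

  -- On the residue class, C(y, l + 1) - C(y + 1, l + 1) = -C(y, l); off it everything vanishes. So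
  -- `∇ q` lowers `l` by one, up to sign.
  ∇-kernel-suc : ∀ l k → ℤ.- + 1 ℤ.* kernel r l q k ≡ ∇ q (kernel r (suc l) q) k
  ∇-kernel-suc l k with (+ q) ∣ᶻ? (+ k ℤ.- r)
  ... | yes (divides y eq) = begin
      ℤ.- + 1 ℤ.* kernel r l q k                              ≡⟨ cong (ℤ.- + 1 ℤ.*_) (kernel-∣ r l q k y eq) ⟩
      ℤ.- + 1 ℤ.* binomℤ y l                                  ≡⟨ lemma (binomℤ y l) (binomℤ y (suc l)) ⟩
      binomℤ y (suc l) ℤ.- (binomℤ y (suc l) ℤ.+ binomℤ y l)
        ≡⟨ cong₂ ℤ._-_ (kernel-∣ r (suc l) q k y eq) (trans (kernel-shift (suc l) k y eq) (binomℤ-pascal y l)) ⟨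
      ∇ q (kernel r (suc l) q) k ∎
      where
      open ≡-Reasoning
      lemma : ∀ a b → ℤ.- + 1 ℤ.* a ≡ b ℤ.- (b ℤ.+ a)
      lemma = solve-∀
  ... | no q∤ = trans (cong (ℤ.- + 1 ℤ.*_) (kernel-∤ r l q k q∤))
      (sym (cong₂ ℤ._-_ (kernel-∤ r (suc l) q k q∤) (kernel-∤ r (suc l) q (k + q) (∤-shift k q∤))))

module _ {p : ℕ} (p-prime : Prime p) (b : ℕ) (r : ℤ) where

  open Weight p (p ^ b * (p ∸ 1))
  private instance
    p≢0 = prime⇒nonZero p-prime
    q≢0 = ℕ.m^n≢0 p (suc b)

  -- `∇ q` applied l + 1 times gives 0, which has every weight with threshold 0; undoing each
  -- application adds q to the threshold.
  Wt-kernel : ∀ l → Wt (suc l * p ^ suc b) 0 (kernel r l (p ^ suc b))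
  Wt-kernel zero    = Wt-∇⇒Wt p-prime b (kernel r 0 (p ^ suc b)) (Wt-cong (∇-kernel-zero r (p ^ suc b)) Wt-0)
  Wt-kernel (suc l) = Wt-∇⇒Wt p-prime b (kernel r (suc l) (p ^ suc b))
    (Wt-cong (∇-kernel-suc r (p ^ suc b) l) (Wt-* (ℤ.- + 1) (kernel r l (p ^ suc b)) (Wt-kernel l)))

-- The sum in ψ as an n-th difference at 0.

term : ℕ → ℤ → ℕ → ℕ → ℕ → ℤ
term n r l q k = if does ((+ q) ∣ᶻ? (+ k ℤ.- r))
             then sgn k ℤ.* (+ (n C k)) ℤ.* binomℤ ((+ k ℤ.- r) ÷ q) l
             else + 0

-- As for totGo; _+_ on ℤ, not being injective for the unifier, is abstracted too.
mutual
  psiGo : ℕ → ℤ → ℕ → ℕ → ℕ → ℤ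
  psiGo = _
  psiGo-spec : ∀ n r l q → psiSum (suc n) r l q ≡ (psiGo (suc n) r l q n ℤ.+ term (suc n) r l q n) ℤ.+ term (suc n) r l q (suc n)
  psiGo-spec n r l q with term (suc n) r l q (suc n) | term (suc n) r l q n | ℤ._+_ | suc n
  ... | a | b | f | w = refl

term≡ : ∀ n r l q k → term n r l q k ≡ signedC n k ℤ.* kernel r l q k
term≡ n r l q k with does ((+ q) ∣ᶻ? (+ k ℤ.- r))
... | true  = refl
... | false = sym (ℤ.*-zeroʳ (signedC n k))

psiGo≡Σ< : ∀ n r l q m → psiGo n r l q m ≡ Σ< m (term n r l q)
psiGo≡Σ< n r l q zero    = refl
psiGo≡Σ< n r l q (suc m) = cong (ℤ._+ term n r l q m) (psiGo≡Σ< n r l q m)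

psiSum≡D : ∀ n r l q → psiSum n r l q ≡ D n (kernel r l q) 0
psiSum≡D n r l q = trans (psiGo≡Σ< n r l q (suc n))
  (trans (Σ<-cong (suc n) (term≡ n r l q)) (sym (D-expansion n (kernel r l q) 0)))

-- Functions supported on one residue class modulo p.

Σ<-single : ∀ n t u → t < n → (∀ i → i < n → i ≢ t → u i ≡ 0ℤ) → Σ< n u ≡ u t
Σ<-single (suc n) t u t<1+n u≡0 with t ℕ.≟ n
... | yes refl = trans (cong (ℤ._+ u n) (Σ<-zero n λ i i<n → u≡0 i (ℕ.m≤n⇒m≤1+n i<n) (ℕ.<⇒≢ i<n))) (ℤ.+-identityˡ (u n))
... | no t≢n = trans
  (cong₂ ℤ._+_ (Σ<-single n t u (ℕ.≤∧≢⇒< (ℕ.s≤s⁻¹ t<1+n) t≢n) λ i i<n → u≡0 i (ℕ.m≤n⇒m≤1+n i<n))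
               (u≡0 n ℕ.≤-refl (t≢n ∘ sym)))
  (ℤ.+-identityʳ (u t))

module _ {p t : ℕ} (g h : Seq) (on : ∀ k → g (t + k * p) ≡ h k)
         (off : ∀ j → j < p → j ≢ t → ∀ k → g (j + k * p) ≡ 0ℤ) where

  private
    next : ∀ j k → j + k * p + p ≡ j + suc k * p
    next j k = trans (ℕ.+-assoc j (k * p) p) (cong (λ m → j + m) (ℕ.+-comm (k * p) p))

  ∇^-on : ∀ n k → fold g (∇ p) n (t + k * p) ≡ D n h k
  ∇^-on zero    k = on k
  ∇^-on (suc n) k = cong₂ ℤ._-_ (∇^-on n k) (trans (cong (fold g (∇ p) n) (next t k)) (∇^-on n (suc k)))

  ∇^-off : ∀ n j → j < p → j ≢ t → ∀ k → fold g (∇ p) n (j + k * p) ≡ 0ℤ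
  ∇^-off zero    j j<p j≢t k = off j j<p j≢t k
  ∇^-off (suc n) j j<p j≢t k = cong₂ ℤ._-_ (∇^-off n j j<p j≢t k)
    (trans (cong (fold g (∇ p) n) (next j k)) (∇^-off n j j<p j≢t (suc k)))

  -- Along the class of t, `∇ p` acts as Δ on `h`. The expansion of Δ^s at 0 only sees the points 0,
  -- ..., s, all below p, among which at most t lies in the class; if t > s then C(s, t) = 0.
  D-∇^-supported : ∀ n s → s < p → D s (fold g (∇ p) n) 0 ≡ signedC s t ℤ.* D n h 0
  D-∇^-supported n s s<p = trans (D-expansion s (fold g (∇ p) n) 0) Σ≡
    where
    u : Seq
    u i = signedC s i ℤ.* fold g (∇ p) n i
    u≡0 : ∀ i → i < suc s → i ≢ t → u i ≡ 0ℤ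
    u≡0 i i≤s i≢t = trans (cong (signedC s i ℤ.*_) (trans (cong (fold g (∇ p) n) (sym (ℕ.+-identityʳ i)))
      (∇^-off n i (ℕ.≤-trans i≤s s<p) i≢t 0))) (ℤ.*-zeroʳ (signedC s i))
    Σ≡ : Σ< (suc s) u ≡ signedC s t ℤ.* D n h 0
    Σ≡ with t ℕ.≤? s
    ... | yes t≤s = trans (Σ<-single (suc s) t u (s≤s t≤s) u≡0)
      (cong (signedC s t ℤ.*_) (trans (cong (fold g (∇ p) n) (sym (ℕ.+-identityʳ t))) (∇^-on n 0)))
    ... | no t≰s = trans (Σ<-zero (suc s) λ i i≤s → u≡0 i i≤s λ i≡t → t≰s (subst (_≤ s) i≡t (ℕ.s≤s⁻¹ i≤s)))
      (sym (trans (cong (λ c → sgn t ℤ.* + c ℤ.* D n h 0) (k>n⇒nCk≡0 (ℕ.≰⇒> t≰s)))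
        (cong (ℤ._* D n h 0) (ℤ.*-zeroʳ (sgn t)))))

-- Comparison of the kernels at the two levels.

residue-unique : ∀ {p j t} → j < p → t < p → + p ∣ᶻ + j ℤ.- + t → j ≡ t
residue-unique {p} {j} {t} j<p t<p p∣ =
  ℤ.+-injective (ℤ.i-j≡0⇒i≡j (+ j) (+ t) (ℤ.∣i∣≡0⇒i≡0 (small ℤ.∣ + j ℤ.- + t ∣ (ℤ.∣⇒∣ᵤ p∣) abs<p)))
  where
  small : ∀ n → p ∣ n → n < p → n ≡ 0
  small zero    _   _   = refl
  small (suc n) p∣n n<p = contradiction (∣⇒≤ p∣n) (ℕ.<⇒≱ n<p)
  abs<p : ℤ.∣ + j ℤ.- + t ∣ < p
  abs<p = ℕ.≤-<-trans (ℕ.≤-trans (ℕ.≤-reflexive (cong ℤ.∣_∣ (ℤ.m-n≡m⊖n j t))) (ℤ.∣m⊝n∣≤m⊔n j t)) (ℕ.⊔-pres-<m j<p t<p)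

module _ (p q : ℕ) .{{_ : ℕ.NonZero p}} .{{_ : ℕ.NonZero q}} (r : ℤ) (t l : ℕ) where

  private
    instance
      pq≢0 = ℕ.m*n≢0 p q
    r′ : ℤ
    r′ = + p ℤ.* r ℤ.+ + t
    index≡ : ∀ j k → + (j + k * p) ℤ.- r′ ≡ (+ j ℤ.- + t) ℤ.+ + p ℤ.* (+ k ℤ.- r)
    index≡ j k = trans (cong (λ m → + j ℤ.+ m ℤ.- r′) (ℤ.pos-* k p)) (lemma (+ j) (+ k) (+ p) r (+ t))
      where
      lemma : ∀ j k p r t → j ℤ.+ k ℤ.* p ℤ.- (p ℤ.* r ℤ.+ t) ≡ (j ℤ.- t) ℤ.+ p ℤ.* (k ℤ.- r)
      lemma = solve-∀
    index-t≡ : ∀ k → + (t + k * p) ℤ.- r′ ≡ + p ℤ.* (+ k ℤ.- r)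
    index-t≡ k = trans (index≡ t k) (trans (cong (ℤ._+ + p ℤ.* (+ k ℤ.- r)) (ℤ.+-inverseʳ (+ t))) (ℤ.+-identityˡ _))

  -- On the class of t the shifted index is p (k - r), so cancelling p matches both the divisibility
  -- condition and the quotient.
  kernel-on : ∀ k → kernel r′ l (p * q) (t + k * p) ≡ kernel r l q k
  kernel-on k with (+ q) ∣ᶻ? (+ k ℤ.- r)
  ... | yes (divides y eq) = trans
    (kernel-∣ r′ l (p * q) (t + k * p) y (begin
      + (t + k * p) ℤ.- r′       ≡⟨ index-t≡ k ⟩
      + p ℤ.* (+ k ℤ.- r)        ≡⟨ cong (+ p ℤ.*_) eq ⟩
      + p ℤ.* (y ℤ.* + q)        ≡⟨ lemma (+ p) y (+ q) ⟩
      y ℤ.* (+ p ℤ.* + q)        ≡⟨ cong (y ℤ.*_) (ℤ.pos-* p q) ⟨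
      y ℤ.* + (p * q)            ∎))
    (sym (kernel-∣ r l q k y eq))
    where
    open ≡-Reasoning
    lemma : ∀ p y q → p ℤ.* (y ℤ.* q) ≡ y ℤ.* (p ℤ.* q)
    lemma = solve-∀
  ... | no q∤ = trans
    (kernel-∤ r′ l (p * q) (t + k * p) λ pq∣ → q∤ (ℤ.*-cancelˡ-∣ (+ p) (subst₂ _∣ᶻ_ (ℤ.pos-* p q) (index-t≡ k) pq∣)))
    (sym (kernel-∤ r l q k q∤))

  kernel-off : t < p → ∀ j → j < p → j ≢ t → ∀ k → kernel r′ l (p * q) (j + k * p) ≡ 0ℤ
  kernel-off t<p j j<p j≢t k = kernel-∤ r′ l (p * q) (j + k * p) λ pq∣ →
    j≢t (residue-unique j<p t<p (ℤ.∣m+n∣n⇒∣m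
      (subst (+ p ∣ᶻ_) (index≡ j k) (ℤ.∣-trans (∣⇒∣ᶻ (m∣m*n q)) pq∣)) (ℤ.∣m⇒∣m*n (+ k ℤ.- r) ℤ.∣-refl)))

-- The normalising exponent at level p ^ (b + 1), and the final congruence.

exponent : (p b l n : ℕ) → ℤ
exponent p b l n = ((+ n ℤ.- + (p ^ b)) ℤ.- + (l * p ^ suc b)) ÷ (p ^ b * (p ∸ 1))

module _ {p : ℕ} (p-prime : Prime p) where

  private instance
    p≢0 = prime⇒nonZero p-prime
    p>1 = prime⇒nonTrivial p-prime

  φ≢0 : ∀ b → ℕ.NonZero (p ^ b * (p ∸ 1))
  φ≢0 b = ℕ.>-nonZero (ℕ.≤-trans (ℕ.>-nonZero⁻¹ (p ^ b) {{ℕ.m^n≢0 p b}}) (p^b≤φ p-prime b))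

  psi≡ : ∀ b l n r → psi p (suc b) l n r ≡ scaleNeg p (exponent p b l n) (D n (kernel r l (p ^ suc b)) 0)
  psi≡ b l n r = cong₂ (λ φ S → scaleNeg p (((+ n ℤ.- + (p ^ b)) ℤ.- + (l * p ^ suc b)) ÷ φ) S)
    (totient-p^ p-prime b) (psiSum≡D n r l (p ^ suc b))

  -- With N = ρ + e φ the numerator at the lower level, the upper one is p N + s = (p ρ + s) + e (p
  -- φ). As ρ < φ and s < p, p ρ + s is again a remainder, so the floor is the same.
  exponent-descent : ∀ b l n s → s < p → exponent p (suc b) l (p * n + s) ≡ exponent p b l n
  exponent-descent b l n s s<p = ÷-unique N′ (exponent p b l n) {{φ≢0 (suc b)}} remainder< (begin
    + (p * n) ℤ.+ + s ℤ.- + (p * u) ℤ.- + (l * (p * q))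
      ≡⟨ cong₂ (λ a b → a ℤ.+ + s ℤ.- b ℤ.- + (l * (p * q))) (ℤ.pos-* p n) (ℤ.pos-* p u) ⟩
    + p ℤ.* + n ℤ.+ + s ℤ.- + p ℤ.* + u ℤ.- + (l * (p * q))
      ≡⟨ cong (λ a → + p ℤ.* + n ℤ.+ + s ℤ.- + p ℤ.* + u ℤ.- a) (trans (cong +_ (swap l p q)) (ℤ.pos-* p (l * q))) ⟩
    + p ℤ.* + n ℤ.+ + s ℤ.- + p ℤ.* + u ℤ.- + p ℤ.* + (l * q)
      ≡⟨ factor (+ p) (+ n) (+ s) (+ u) (+ (l * q)) ⟩
    + p ℤ.* N ℤ.+ + s
      ≡⟨ cong (λ a → + p ℤ.* a ℤ.+ + s) (÷-division N φ {{φ≢0 b}}) ⟩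
    + p ℤ.* (+ ρ ℤ.+ e ℤ.* + φ) ℤ.+ + s
      ≡⟨ expand (+ p) (+ ρ) e (+ φ) (+ s) ⟩
    + p ℤ.* + ρ ℤ.+ + s ℤ.+ e ℤ.* (+ p ℤ.* + φ)
      ≡⟨ cong₂ (λ a b → a ℤ.+ + s ℤ.+ e ℤ.* b) (ℤ.pos-* p ρ) (trans (cong +_ (ℕ.*-assoc p u (p ∸ 1))) (ℤ.pos-* p φ)) ⟨
    + (p * ρ + s) ℤ.+ e ℤ.* + (p * u * (p ∸ 1)) ∎)
    where
    open ≡-Reasoning
    u q φ : ℕ
    u = p ^ b
    q = p ^ suc b
    φ = u * (p ∸ 1)
    N N′ e : ℤ
    N = + n ℤ.- + u ℤ.- + (l * q)
    N′ = + (p * n + s) ℤ.- + (p * u) ℤ.- + (l * (p * q))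
    e = exponent p b l n
    ρ = _%ℕ_ N φ {{φ≢0 b}}
    remainder< : p * ρ + s < p * u * (p ∸ 1)
    remainder< = ℕ.<-≤-trans (ℕ.+-monoʳ-< (p * ρ) s<p) (ℕ.≤-trans (ℕ.≤-reflexive (trans (ℕ.+-comm (p * ρ) p) (sym (ℕ.*-suc p ρ))))
      (ℕ.≤-trans (ℕ.*-monoʳ-≤ p (n%ℕd<d N φ {{φ≢0 b}})) (ℕ.≤-reflexive (sym (ℕ.*-assoc p u (p ∸ 1))))))
    swap : ∀ l p q → l * (p * q) ≡ p * (l * q)
    swap = ℕSolver.solve-∀
    factor : ∀ p n s u v → p ℤ.* n ℤ.+ s ℤ.- p ℤ.* u ℤ.- p ℤ.* v ≡ p ℤ.* (n ℤ.- u ℤ.- v) ℤ.+ s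
    factor = solve-∀
    expand : ∀ p ρ e φ s → p ℤ.* (ρ ℤ.+ e ℤ.* φ) ℤ.+ s ≡ p ℤ.* ρ ℤ.+ s ℤ.+ e ℤ.* (p ℤ.* φ)
    expand = solve-∀

  exponent-bound : ∀ b l n {e} → exponent p b l n ≡ + e → p ^ b * (p ∸ 1) * e + (p ^ b + l * p ^ suc b) ≤ n
  exponent-bound b l n {e} eq = subst (φ * e + (u + v) ≤_) (sym n≡) (ℕ.≤-trans (ℕ.m≤n+m _ ρ) (ℕ.≤-reflexive (reorder ρ e φ u v)))
    where
    u v φ : ℕ
    u = p ^ b
    v = l * p ^ suc b
    φ = u * (p ∸ 1)
    N : ℤ
    N = + n ℤ.- + u ℤ.- + v
    ρ = _%ℕ_ N φ {{φ≢0 b}}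
    reorder : ∀ ρ e φ u v → ρ + (φ * e + (u + v)) ≡ ρ + e * φ + u + v
    reorder = ℕSolver.solve-∀
    n≡ : n ≡ ρ + e * φ + u + v
    n≡ = ℤ.+-injective (begin
      + n                                          ≡⟨ lemma (+ n) (+ u) (+ v) ⟩
      N ℤ.+ + u ℤ.+ + v                            ≡⟨ cong (λ m → m ℤ.+ + u ℤ.+ + v) (÷-division N φ {{φ≢0 b}}) ⟩
      + ρ ℤ.+ (N ÷ φ) ℤ.* + φ ℤ.+ + u ℤ.+ + v       ≡⟨ cong (λ m → + ρ ℤ.+ m ℤ.* + φ ℤ.+ + u ℤ.+ + v) eq ⟩
      + ρ ℤ.+ + e ℤ.* + φ ℤ.+ + u ℤ.+ + v           ≡⟨ cong (λ m → + ρ ℤ.+ m ℤ.+ + u ℤ.+ + v) (ℤ.pos-* e φ) ⟨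
      + (ρ + e * φ + u + v)                        ∎)
      where
      open ≡-Reasoning
      lemma : ∀ n u v → n ≡ n ℤ.- u ℤ.- v ℤ.+ u ℤ.+ v
      lemma = solve-∀

  -- This is the integrality of ψ for a nonnegative exponent. As q = p ^ b + φ, the bound φ (e + 1)
  -- + p ^ b + l q ≤ n is φ e + (l + 1) q ≤ n, the threshold of the kernel.
  p^exponent∣ : ∀ b l n r {e} → exponent p b l n ≡ + e → + (p ^ e) ∣ᶻ D n (kernel r l (p ^ suc b)) 0
  p^exponent∣ b l n r {zero}  eq = divides (D n (kernel r l (p ^ suc b)) 0) (sym (ℤ.*-identityʳ _))
  p^exponent∣ b l n r {suc e} eq = Wt-kernel p-prime b r l e n bound 0
    where
    u φ : ℕ
    u = p ^ b
    φ = u * (p ∸ 1)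
    bound : φ * e + suc l * p ^ suc b ≤ n
    bound = ℕ.≤-trans (ℕ.≤-reflexive (trans (cong (λ q → φ * e + (q + l * p ^ suc b)) (sym (p^b+φ≡q p-prime b)))
      (reorder φ e u (l * p ^ suc b)))) (exponent-bound b l n eq)
      where
      reorder : ∀ φ e u v → φ * e + (u + φ + v) ≡ φ * suc e + (u + v)
      reorder = ℕSolver.solve-∀

  D-kernel-congruence : ∀ b l n s t r {e} → 1 ≤ b → s < p → t < p → exponent p b l n ≡ + e →
    + (p ^ suc e) ∣ᶻ D (p * n + s) (kernel (+ p ℤ.* r ℤ.+ + t) l (p ^ suc (suc b))) 0
                   ℤ.- signedC s t ℤ.* D n (kernel r l (p ^ suc b)) 0
  D-kernel-congruence (suc b) l n s t r {e} _ s<p t<p eq =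
    subst (+ (p ^ suc e) ∣ᶻ_) (cong₂ ℤ._-_ (cong (λ m → D m f 0) (reorder s n p))
      (D-∇^-supported f (kernel r l q) (kernel-on p q r t l) (kernel-off p q r t l t<p) n s s<p))
      (∇^-congruence p-prime f p∣φ₀ p∣U₀ 2p≤pφ₀ wf n s e (exponent-bound (suc b) l n eq))
    where
    q φ₀ U₀ : ℕ
    q = p ^ suc (suc b)
    φ₀ = p ^ suc b * (p ∸ 1)
    U₀ = p ^ suc b + l * q
    instance
      q≢0 = ℕ.m^n≢0 p (suc (suc b))
      p^b≢0 = ℕ.m^n≢0 p b
    f : Seq
    f = kernel (+ p ℤ.* r ℤ.+ + t) l (p * q)
    reorder : ∀ s n p → s + n * p ≡ p * n + s
    reorder = ℕSolver.solve-∀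
    -- The lower level is p ^ (b + 2), so `φ₀` and `U₀` both contain the factor p ^ (b + 1); this is
    -- where a ≥ 2 enters.
    p∣φ₀ : p ∣ φ₀
    p∣φ₀ = ∣m⇒∣m*n (p ∸ 1) (m∣m*n (p ^ b))
    p∣U₀ : p ∣ U₀
    p∣U₀ = ∣m∣n⇒∣m+n (m∣m*n (p ^ b)) (∣n⇒∣m*n l (m∣m*n (p ^ suc b)))
    2p≤pφ₀ : p + p ≤ p * φ₀
    2p≤pφ₀ = ℕ.≤-trans (ℕ.≤-reflexive (double p)) (ℕ.*-monoʳ-≤ p
      (ℕ.≤-trans (ℕ.nonTrivial⇒n>1 p) (ℕ.≤-trans (ℕ.m≤m*n p (p ^ b)) (p^b≤φ p-prime (suc b)))))
      where
      double : ∀ p → p + p ≡ p * 2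
      double = ℕSolver.solve-∀
    wf : Weight.Wt p (p * φ₀) (p * U₀ + p * φ₀) 0 f
    wf = subst₂ (λ φ T → Weight.Wt p φ T 0 f) (ℕ.*-assoc p (p ^ suc b) (p ∸ 1)) T≡ (Wt-kernel p-prime (suc (suc b)) (+ p ℤ.* r ℤ.+ + t) l)
      where
      T≡ : suc l * (p * q) ≡ p * U₀ + p * φ₀
      T≡ = trans (regroup l p q) (trans (cong (λ m → p * (m + l * q)) (sym (p^b+φ≡q p-prime (suc b)))) (regroup′ p (p ^ suc b) φ₀ (l * q)))
        where
        regroup : ∀ l p q → suc l * (p * q) ≡ p * (q + l * q)
        regroup = ℕSolver.solve-∀
        regroup′ : ∀ p u φ v → p * (u + φ + v) ≡ p * (u + v) + p * φ
        regroup′ = ℕSolver.solve-∀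

  -- For a negative exponent both scaled values are multiples of p. Otherwise the divisions are
  -- exact, and the congruence modulo p ^ (k + 1) can be divided by p ^ k.
  scaleNeg-congruence : ∀ e c x y →
    (∀ {k} → e ≡ + k → + (p ^ k) ∣ᶻ x × + (p ^ k) ∣ᶻ y × + (p ^ suc k) ∣ᶻ x ℤ.- c ℤ.* y) →
    + p ∣ᶻ scaleNeg p e x ℤ.- c ℤ.* scaleNeg p e y
  scaleNeg-congruence -[1+ k ] c x y _ = ℤ.∣m∣n⇒∣m-n (p∣scaled x) (ℤ.∣n⇒∣m*n c (p∣scaled y))
    where
    p∣scaled : ∀ z → + p ∣ᶻ z ℤ.* ((+ p) ^ℤ suc k)
    p∣scaled z = ℤ.∣n⇒∣m*n z (ℤ.∣m⇒∣m*n ((+ p) ^ℤ k) ℤ.∣-refl)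
  scaleNeg-congruence (+ k) c x y hyp with hyp refl
  ... | divides x₀ x≡ , divides y₀ y≡ , p^[1+k]∣ = subst₂ (λ x y → + p ∣ᶻ x ℤ.- c ℤ.* y)
    (sym (÷-exact x₀ (p ^ k) x≡)) (sym (÷-exact y₀ (p ^ k) y≡))
    (ℤ.*-cancelʳ-∣ (+ (p ^ k)) (subst₂ _∣ᶻ_ (ℤ.pos-* p (p ^ k)) difference≡ p^[1+k]∣))
    where
    instance p^k≢0 = ℕ.m^n≢0 p k
    difference≡ : x ℤ.- c ℤ.* y ≡ (x₀ ℤ.- c ℤ.* y₀) ℤ.* + (p ^ k)
    difference≡ = trans (cong₂ (λ x y → x ℤ.- c ℤ.* y) x≡ y≡) (lemma x₀ c y₀ (+ (p ^ k)))
      where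
      lemma : ∀ x c y d → x ℤ.* d ℤ.- c ℤ.* (y ℤ.* d) ≡ (x ℤ.- c ℤ.* y) ℤ.* d
      lemma = solve-∀

theorem1p1 : (p : ℕ) → Prime p → (r : ℤ) → (a l n s t : ℕ) →
    a ≥ 2 → s < p → t < p →
    psi p (a + 1) l (p * n + s) ((+ p) ℤ.* r ℤ.+ (+ t))
    ≡ (sgn t ℤ.* (+ (s C t))) ℤ.* psi p a l n r [mod p ]
-- The rewrite turns the upper level `suc b + 1` into `suc (suc b)`, and `descent` lets both sides
-- be scaled by one and the same exponent.
theorem1p1 p p-prime r (suc b) l n s t (s≤s 1≤b) s<p t<p rewrite ℕ.+-comm b 1 = ℤ.∣⇒∣ᵤ
  (subst₂ (λ x y → + p ∣ᶻ x ℤ.- signedC s t ℤ.* y)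
    (sym (trans (psi≡ p-prime (suc b) l (p * n + s) r′) (cong (λ e → scaleNeg p e X) descent)))
    (sym (psi≡ p-prime b l n r))
    (scaleNeg-congruence p-prime (exponent p b l n) (signedC s t) X Y λ e≡ →
      p^exponent∣ p-prime (suc b) l (p * n + s) r′ (trans descent e≡) ,
      p^exponent∣ p-prime b l n r e≡ ,
      D-kernel-congruence p-prime b l n s t r 1≤b s<p t<p e≡))
  where
  r′ X Y : ℤ
  r′ = + p ℤ.* r ℤ.+ + t
  X = D (p * n + s) (kernel r′ l (p ^ suc (suc b))) 0
  Y = D n (kernel r l (p ^ suc b)) 0
  descent : exponent p (suc b) l (p * n + s) ≡ exponent p b l n
  descent = exponent-descent p-prime b l n s s<p
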